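{- Let $L$ be a countable metric signature and let $\Omega$ be a universal weak modulus for $L$. Let $A$ and $B$ be separable $L$-structures and let $\bar v\in A^k$, $\bar w\in B^k$. Then $$r_\infty^\Omega(A\bar v,B\bar w)=\inf\{d^\Omega(f(\bar v),\bar w): f\text{ is an isomorphism }A\to B\}$$ (with $\inf\emptyset=\infty$). In particular, $r^\Omega_\infty(A,B)=0$ if $A\cong B$, and $r^\Omega_\infty(A,B)=\infty$ otherwise.
   Context: Moduli. For $n\in\mathbb N$ or $n=\mathbb N$, an $n$-ary modulus is a continuous function $\Delta:[0,\infty)^n\to[0,\infty)$ with $\Delta(0)=0$ and $\Delta(\delta)\le\Delta(\delta+\delta')\le\Delta(\delta)+\Delta(\delta')$. A weak modulus is a function $\Omega:[0,\infty)^{\mathbb N}\to[0,\infty]$ with $\Omega(0)=0$ and $\Omega(\delta)\le\Omega(\delta+\delta')\le\Omega(\delta)+\Omega(\delta')$ that is lower semicontinuous for the product topology and separately continuous in each argument; put $\Omega|_n(\delta_0,\dots,\delta_{n-1})=\Omega(\delta_0,\dots,\delta_{n-1},0,0,\dots)$. For $n$-tuples in a metric space, $d^\Omega(\bar a,\bar b)=\Omega|_n(d(a_0,b_0),\dots,d(a_{n-1},b_{n-1}))$. $\Omega$ is shift-increasing if for all $i_0<i_1<\cdots$ and all $\delta$, $\Omega(\delta)\le\Omega(\delta')$, where $\delta'_{i_p}=\delta_p$ and $\delta'_k=0$ for $k\notin\{i_0,i_1,\dots\}$. A map $f$ from a product of metric spaces $\prod_{i<n}X_i$ to a metric space respects $\Delta$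 if $d(f(x),f(y))\le\Delta((d(x_i,y_i))_{i<n})$ for all $x,y$. Signatures and structures. A metric signature $L$ is a set of function and predicate symbols; each symbol $s$ has an arity $n_s$ and an $n_s$-ary modulus $\Delta_s$, and each predicate symbol $P$ also has a compact interval $I_P\subseteq\mathbb R$ (its bound). $L$ always contains a binary predicate symbol $d$ with $\Delta_d(\delta_1,\delta_2)=\delta_1+\delta_2$ and some bound. An $L$-structure $A$ is a complete metric space with maps $F^A:A^{n_F}\to A$ respecting $\Delta_F$ and functions $P^A:A^{n_P}\to I_P$ respecting $\Delta_P$, where $d$ is interpreted as the distance. Isomorphisms are bijections preserving all symbols (including $d$). Basic formulas. Variables are $x_0,x_1,\dots$. $\Delta_{x_i}(\delta)=\delta_i$; $\Delta_{F(\bar\tau)}=\Delta_F\circ(\Delta_{\tau_i})_i$ for terms; an atomic formula $P(\bar\tau)$ has modulus $\Delta_P\circ(\Delta_{\tau_i})_i$ and bound $I_P$. A basic formula is $\phi=f(\phi_0,\dots,\phi_{m-1})$ with $\phi_i$ atomic and $f:\prod_i I_{\phi_i}\to\mathbb R$ continuous; its modulus is $\Delta_\phi=\Delta_f\circ(\Delta_{\phi_i})_i$, where $\Delta_f(\delta)=\sup\{|f(x)-f(y)|:|x_i-y_i|\le\delta_i\}$. $\phi^A$ is the interpretation of $\phi$ in $A$. Universal weak modulus for $L$: a weak modulus $\Omega$ such that (1) for every atomic formula $\phi(x_0,\dots,x_{k-1})$ there is $n$ with $\Delta_\phi(\delta_0,\dots,\delta_{k-1})\le\Omega|_n(0,\dots,0,\delta_0,\dots,\delta_{k-1})$;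 (2) for all $k\in\mathbb N$, $M>0$ there is $n$ with $M\cdot\Omega|_k(\delta_0,\dots,\delta_{k-1})\le\Omega|_n(0,\dots,0,\delta_0,\dots,\delta_{k-1})$; (3) $\Omega|_k(\delta_0,\dots,\delta_{k-1})+\Omega|_n(\gamma_0,\dots,\gamma_{n-1})\le\Omega|_{k+n}(\delta_0,\dots,\delta_{k-1},\gamma_0,\dots,\gamma_{n-1})$ for all $k,n$; (4) $\Omega$ is shift-increasing. Back-and-forth pseudo-distances $r_\alpha=r_\alpha^\Omega$ (with respect to $\Omega$), with values in $[0,\infty]$, for $\bar a\in A^n,\bar b\in B^n$: $r_0(A\bar a,B\bar b)=\sup_\phi|\phi^A(\bar a)-\phi^B(\bar b)|$ over all basic formulas $\phi(x_0,\dots,x_{n-1})$ with $\Delta_\phi\le\Omega|_n$; $r_\alpha=\sup_{\beta<\alpha}r_\beta$ for $\alpha$ limit or $\alpha=\infty$ (greater than all ordinals); $r_{\alpha+1}(A\bar a,B\bar b)=\sup_{c\in A,d\in B}\inf_{c'\in A,d'\in B}\max\bigl(r_\alpha(A\bar ac,B\bar bd'),r_\alpha(A\bar ac',B\bar bd)\bigr)$. For $n=0$ write $r_\alpha(A,B)$. -}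

module Defs where

open import Level using (0ℓ)
open import Algebra.Bundles using (CommutativeRing)
import Algebra.Construct.NaturalChoice.Max as Max
open import Axiom.ExcludedMiddle using (ExcludedMiddle)
open import Data.Empty using (⊥)
open import Data.Fin.Base using (Fin; zero; suc; fromℕ)
open import Data.Maybe.Base using (Maybe; just; nothing)
open import Data.Nat.Base as ℕ using (ℕ; zero; suc)
open import Data.Product.Base using (∃; ∃-syntax; Σ-syntax; _×_; _,_; proj₁; proj₂)
open import Data.Sum.Base using (_⊎_; inj₁; inj₂)
open import Data.Unit.Base using (⊤; tt)
open import Data.Vec.Functional using (Vector; replicate; insertAt; tail; _++_)
open import Function.Base using (_∘_)
open import Function.Bundles using (_↣_)
open import Function.Metric.Structures using (IsGeneralMetric)
open import Function.Structures using (IsBijection)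
open import Relation.Binary.Bundles using (TotalOrder)
import Relation.Binary.Construct.NonStrictToStrict as Strict
open import Relation.Binary.Core using (Rel)
open import Relation.Binary.PropositionalEquality.Core using (_≡_)
open import Relation.Binary.Structures using (IsTotalOrder)
open import Relation.Nullary using (¬_; Dec; yes; no; contradiction)
open import Relation.Nullary.Decidable using (True; toWitness; fromWitness)

-- Dedekind-complete ordered fields, which determine ℝ up to unique isomorphism.
record CompleteOrderedField : Set₁ where
  field
    commutativeRing : CommutativeRing 0ℓ 0ℓ
  open CommutativeRing commutativeRing public
  infix 4 _≤_
  field
    _≤_          : Rel Carrier 0ℓ
    isTotalOrder : IsTotalOrder _≈_ _≤_
    +-monoˡ-≤    : ∀ z {x y} → x ≤ y → x + z ≤ y + z
    *-nonneg     : ∀ {x y} → 0# ≤ x → 0# ≤ y → 0# ≤ x * y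
    0≉1          : ¬ 0# ≈ 1#
    inverse      : ∀ x → ¬ x ≈ 0# → ∃[ y ] x * y ≈ 1#
    lub          : (P : Carrier → Set) → ∃ P → (∃[ b ] ∀ x → P x → x ≤ b) →
                   ∃[ s ] (∀ x → P x → x ≤ s) × (∀ b → (∀ x → P x → x ≤ b) → s ≤ b)

  totalOrder : TotalOrder 0ℓ 0ℓ 0ℓ
  totalOrder = record { isTotalOrder = isTotalOrder }

-- Well-founded trees denoting ordinals: lim I f denotes the supremum of the f i.
-- The order type of every well-order on a type in Set is denoted by some tree.
-- _≤ₒ_ and _<ₒ_ compare the denoted ordinals.
data Ord : Set₁ where
  zero : Ord
  suc  : Ord → Ord
  lim  : (I : Set) → (I → Ord) → Ord

infix 4 _≤ₒ_ _<ₒ_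

mutual
  _≤ₒ_ : Ord → Ord → Set
  zero    ≤ₒ β = ⊤
  suc α   ≤ₒ β = α <ₒ β
  lim I f ≤ₒ β = ∀ i → f i ≤ₒ β

  _<ₒ_ : Ord → Ord → Set
  α <ₒ zero    = ⊥
  α <ₒ suc β   = α ≤ₒ β
  α <ₒ lim I f = ∃[ i ] α <ₒ f i

-- Each occurrence of lim denotes a limit ordinal: the family is inhabited and
-- has no largest member.
IsOrdinal : Ord → Set
IsOrdinal zero      = ⊤
IsOrdinal (suc α)   = IsOrdinal α
IsOrdinal (lim I f) = I × (∀ i → IsOrdinal (f i)) × (∀ i → ∃[ j ] f i <ₒ f j)

-- An index set for the ordinals strictly below a given one.
Below : Ord → Set
Below zero      = ⊥
Below (suc α)   = Maybe (Below α)
Below (lim I f) = Σ[ i ∈ I ] Below (f i)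

-- The mathematics is classical. Excluded middle is what makes suprema and infima
-- of arbitrary families total functions below; since it applies to all types, and
-- Σ-types carry their witnesses, it also provides the axiom of choice.
module Theory (em : ∀ {ℓ} → ExcludedMiddle ℓ) (ℝ : CompleteOrderedField) where

  open CompleteOrderedField ℝ public
    using (_≈_; _≤_; _+_; _*_; -_; _-_; 0#; 1#)
    renaming (Carrier to Real)
  private
    module R = CompleteOrderedField ℝ
    module T = IsTotalOrder R.isTotalOrder
  open Strict _≈_ _≤_ public using (_<_)
  open Max R.totalOrder using () renaming (_⊔_ to max)

  ∣_∣ : Real → Real
  ∣ x ∣ = max x (- x)

  private
    +-nonneg : ∀ {x y} → 0# ≤ x → 0# ≤ y → 0# ≤ x + y
    +-nonneg {x} {y} 0≤x 0≤y =
      T.trans 0≤y (T.trans (T.reflexive (R.sym (R.+-identityˡ y))) (R.+-monoˡ-≤ y 0≤x))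

    neg-nonneg : ∀ {x} → x ≤ 0# → 0# ≤ - x
    neg-nonneg {x} x≤0 =
      T.trans (T.reflexive (R.sym (R.-‿inverseʳ x)))
        (T.trans (R.+-monoˡ-≤ (- x) x≤0) (T.reflexive (R.+-identityˡ (- x))))

    ∣∣-nonneg : ∀ x → 0# ≤ ∣ x ∣
    ∣∣-nonneg x with T.total 0# x
    ... | inj₁ 0≤x = T.trans 0≤x (Max.x≤x⊔y R.totalOrder x (- x))
    ... | inj₂ x≤0 = T.trans (neg-nonneg x≤0) (Max.x≤y⊔x R.totalOrder x (- x))

  record ℝ≥0 : Set where
    constructor _,⁺_
    field
      val    : Real
      nonneg : 0# ≤ val
  open ℝ≥0 public

  0⁺ : ℝ≥0
  0⁺ = 0# ,⁺ T.refl

  infixl 6 _+⁺_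
  _+⁺_ : ℝ≥0 → ℝ≥0 → ℝ≥0
  x +⁺ y = (val x + val y) ,⁺ +-nonneg (nonneg x) (nonneg y)

  infixl 7 _*⁺_
  _*⁺_ : ℝ≥0 → ℝ≥0 → ℝ≥0
  x *⁺ y = (val x * val y) ,⁺ R.*-nonneg (nonneg x) (nonneg y)

  ∣_∣⁺ : Real → ℝ≥0
  ∣ x ∣⁺ = ∣ x ∣ ,⁺ ∣∣-nonneg x

  data [0,∞] : Set where
    fin : ℝ≥0 → [0,∞]
    ∞   : [0,∞]

  infix 4 _≤∞_ _≈∞_
  _≤∞_ : Rel [0,∞] 0ℓ
  x     ≤∞ ∞     = ⊤
  ∞     ≤∞ fin _ = ⊥
  fin x ≤∞ fin y = val x ≤ val y

  _≈∞_ : Rel [0,∞] 0ℓ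
  fin x ≈∞ fin y = val x ≈ val y
  ∞     ≈∞ ∞     = ⊤
  fin _ ≈∞ ∞     = ⊥
  ∞     ≈∞ fin _ = ⊥

  open Strict _≈∞_ _≤∞_ public using () renaming (_<_ to _<∞_)

  infixl 6 _+∞_
  _+∞_ : [0,∞] → [0,∞] → [0,∞]
  fin x +∞ fin y = fin (x +⁺ y)
  fin _ +∞ ∞     = ∞
  ∞     +∞ _     = ∞

  -- Used only for positive scalars, so that ∞ is always sent to ∞.
  infixl 7 _·∞_
  _·∞_ : ℝ≥0 → [0,∞] → [0,∞]
  M ·∞ fin x = fin (M *⁺ x)
  M ·∞ ∞     = ∞

  max∞ : [0,∞] → [0,∞] → [0,∞]
  max∞ (fin x) (fin y) = fin (max (val x) (val y) ,⁺ T.trans (nonneg x) (Max.x≤x⊔y R.totalOrder (val x) (val y)))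
  max∞ (fin _) ∞       = ∞
  max∞ ∞       _       = ∞

  -- The supremum is taken in [0,∞]; in particular that of the empty family is 0.
  module _ {ℓ} {I : Set ℓ} (f : I → [0,∞]) where

    private
      Bounded : Set ℓ
      Bounded = ∃[ b ] ∀ i → f i ≤∞ fin b

      -- Reals below every finite upper bound; True brings the predicate down to Set.
      Lower : Real → Set ℓ
      Lower x = ∀ b → (∀ i → f i ≤∞ fin b) → x ≤ val b

      lower-lub : Bounded → _
      lower-lub (b , f≤b) =
        R.lub (λ x → True (em {P = Lower x}))
              (0# , fromWitness (λ c _ → nonneg c))
              (val b , λ x x∈ → toWitness x∈ b f≤b)

      finite-sup : Bounded → ℝ≥0
      finite-sup B = let s , s-upper , _ = lower-lub B in
        s ,⁺ s-upper 0# (fromWitness (λ c _ → nonneg c))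

      sup-from : Dec Bounded → [0,∞]
      sup-from (yes B) = fin (finite-sup B)
      sup-from (no  _) = ∞

    sup : [0,∞]
    sup = sup-from em

    sup-upper : ∀ i → f i ≤∞ sup
    sup-upper i = go em
      where
      bounded : (B : Bounded) → ∀ y → y ≤∞ fin (proj₁ B) →
                (∀ c → (∀ j → f j ≤∞ fin c) → y ≤∞ fin c) → y ≤∞ fin (finite-sup B)
      bounded B (fin x) _ y≤ = proj₁ (proj₂ (lower-lub B)) (val x) (fromWitness y≤)

      go : (B? : Dec Bounded) → f i ≤∞ sup-from B?
      go (no _)            = tt
      go (yes B@(_ , f≤b)) = bounded B (f i) (f≤b i) (λ c f≤c → f≤c i)

    sup-least : ∀ u → (∀ i → f i ≤∞ u) → sup ≤∞ u
    sup-least u = go em u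
      where
      go : (B? : Dec Bounded) → ∀ u → (∀ i → f i ≤∞ u) → sup-from B? ≤∞ u
      go _       ∞       _   = tt
      go (no ¬B) (fin u) f≤u = contradiction (u , f≤u) ¬B
      go (yes B) (fin u) f≤u = proj₂ (proj₂ (lower-lub B)) (val u) (λ x x∈ → toWitness x∈ u f≤u)

  -- The infimum of the empty family is ∞.
  module _ {ℓ} {I : Set ℓ} (f : I → [0,∞]) where

    inf : [0,∞]
    inf = sup {I = Σ[ l ∈ [0,∞] ] (∀ i → l ≤∞ f i)} proj₁

    inf-lower : ∀ i → inf ≤∞ f i
    inf-lower i = sup-least proj₁ (f i) (λ (_ , l≤f) → l≤f i)

    inf-greatest : ∀ l → (∀ i → l ≤∞ f i) → l ≤∞ inf
    inf-greatest l l≤f = sup-upper proj₁ (l , l≤f)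

  infixl 6 _⊕_
  _⊕_ : ∀ {I : Set} → (I → ℝ≥0) → (I → ℝ≥0) → (I → ℝ≥0)
  (δ ⊕ δ′) i = δ i +⁺ δ′ i

  record Modulus (n : ℕ) : Set where
    field
      Δ          : Vector ℝ≥0 n → ℝ≥0
      at-zero    : val (Δ (λ _ → 0⁺)) ≈ 0#
      mono       : ∀ δ δ′ → val (Δ δ) ≤ val (Δ (δ ⊕ δ′))
      subadd     : ∀ δ δ′ → val (Δ (δ ⊕ δ′)) ≤ val (Δ δ) + val (Δ δ′)
      continuous : ∀ δ ε → 0# < ε → ∃[ η ] 0# < η ×
                   (∀ δ′ → (∀ i → ∣ val (δ i) - val (δ′ i) ∣ < η) →
                    ∣ val (Δ δ) - val (Δ δ′) ∣ < ε)

  Sequence : Set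
  Sequence = ℕ → ℝ≥0

  infixl 8 _[_≔_]
  _[_≔_] : Sequence → ℕ → ℝ≥0 → Sequence
  (δ [ zero  ≔ x ]) zero    = x
  (δ [ zero  ≔ x ]) (suc j) = δ (suc j)
  (δ [ suc i ≔ x ]) zero    = δ zero
  (δ [ suc i ≔ x ]) (suc j) = ((δ ∘ suc) [ i ≔ x ]) j

  -- In the last three fields t ranges over [0,∞); the sets (t,∞] and [0,t) form a
  -- subbase for the topology of [0,∞].
  record WeakModulus : Set where
    field
      Ω      : Sequence → [0,∞]
      at-zero : Ω (λ _ → 0⁺) ≈∞ fin 0⁺
      mono   : ∀ δ δ′ → Ω δ ≤∞ Ω (δ ⊕ δ′)
      subadd : ∀ δ δ′ → Ω (δ ⊕ δ′) ≤∞ Ω δ +∞ Ω δ′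
      lower-semicontinuous :
        ∀ δ t → fin t <∞ Ω δ → ∃[ N ] ∃[ η ] 0# < η ×
        (∀ δ′ → (∀ i → i ℕ.< N → ∣ val (δ i) - val (δ′ i) ∣ < η) → fin t <∞ Ω δ′)
      separately-continuous-lower :
        ∀ δ i x t → fin t <∞ Ω (δ [ i ≔ x ]) → ∃[ η ] 0# < η ×
        (∀ y → ∣ val x - val y ∣ < η → fin t <∞ Ω (δ [ i ≔ y ]))
      separately-continuous-upper :
        ∀ δ i x t → Ω (δ [ i ≔ x ]) <∞ fin t → ∃[ η ] 0# < η ×
        (∀ y → ∣ val x - val y ∣ < η → Ω (δ [ i ≔ y ]) <∞ fin t)

  pad : ∀ {n} → Vector ℝ≥0 n → Sequence
  pad {zero}  δ _       = 0⁺
  pad {suc n} δ zero    = δ zero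
  pad {suc n} δ (suc i) = pad (tail δ) i

  -- Ω ↾ δ is Ω|ₙ(δ) for δ of length n.
  infix 9 _↾_
  _↾_ : WeakModulus → ∀ {n} → Vector ℝ≥0 n → [0,∞]
  Ω ↾ δ = WeakModulus.Ω Ω (pad δ)

  ShiftIncreasing : WeakModulus → Set
  ShiftIncreasing W = ∀ (i : ℕ → ℕ) → (∀ p q → p ℕ.< q → i p ℕ.< i q) → ∀ δ δ′ →
    (∀ p → val (δ′ (i p)) ≈ val (δ p)) →
    (∀ k → (∀ p → ¬ k ≡ i p) → val (δ′ k) ≈ 0#) →
    Ω δ ≤∞ Ω δ′
    where open WeakModulus W using (Ω)

  record Interval : Set where
    field
      lo hi : Real
      lo≤hi : lo ≤ hi

  infix 4 _∈ᴵ_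
  _∈ᴵ_ : Real → Interval → Set
  x ∈ᴵ I = Interval.lo I ≤ x × x ≤ Interval.hi I

  ⟦_⟧ : Interval → Set
  ⟦ I ⟧ = Σ[ x ∈ Real ] x ∈ᴵ I

  -- RelSym lists the predicate symbols other than the symbol for the distance.
  record Signature : Set₁ where
    field
      FunSym     : Set
      RelSym     : Set
      fun-arity  : FunSym → ℕ
      fun-mod    : ∀ F → Modulus (fun-arity F)
      rel-arity  : RelSym → ℕ
      rel-mod    : ∀ R → Modulus (rel-arity R)
      rel-bound  : RelSym → Interval
      dist-bound : Interval

  module _ (L : Signature) where
    open Signature L

    data PredSym : Set where
      dist : PredSym
      rel  : RelSym → PredSym

    Countable : Set
    Countable = (FunSym ⊎ PredSym) ↣ ℕ

    arity : PredSym → ℕ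
    arity dist    = 2
    arity (rel R) = rel-arity R

    bound : PredSym → Interval
    bound dist    = dist-bound
    bound (rel R) = rel-bound R

    Δᴾ : ∀ P → Vector ℝ≥0 (arity P) → ℝ≥0
    Δᴾ dist    δ = δ zero +⁺ δ (suc zero)
    Δᴾ (rel R) δ = Modulus.Δ (rel-mod R) δ

  -- Structures are nonempty, as usual in model theory. If exactly one of A, B were
  -- empty, the suprema over A × B in the back-and-forth step would be empty.
  record Structure (L : Signature) : Set₁ where
    open Signature L
    infix 4 _≈ₛ_
    field
      Carrier  : Set
      _≈ₛ_     : Rel Carrier 0ℓ
      d        : Carrier → Carrier → Real
      isMetric : IsGeneralMetric _≈ₛ_ _≈_ _≤_ 0# _+_ d
      nonempty : Carrier

    d⁺ : Carrier → Carrier → ℝ≥0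
    d⁺ x y = d x y ,⁺ IsGeneralMetric.nonNegative isMetric

    field
      complete : ∀ (s : ℕ → Carrier) →
        (∀ ε → 0# < ε → ∃[ N ] ∀ m n → N ℕ.≤ m → N ℕ.≤ n → d (s m) (s n) < ε) →
        ∃[ x ] ∀ ε → 0# < ε → ∃[ N ] ∀ n → N ℕ.≤ n → d (s n) x < ε
      fun : ∀ F → Vector Carrier (fun-arity F) → Carrier
      fun-respects : ∀ F x y →
        d (fun F x) (fun F y) ≤ val (Modulus.Δ (fun-mod F) (λ i → d⁺ (x i) (y i)))
      relation : ∀ R → Vector Carrier (rel-arity R) → ⟦ rel-bound R ⟧
      relation-respects : ∀ R x y →
        ∣ proj₁ (relation R x) - proj₁ (relation R y) ∣ ≤
        val (Modulus.Δ (rel-mod R) (λ i → d⁺ (x i) (y i)))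
      d-bounded : ∀ x y → d x y ∈ᴵ dist-bound

    pred : ∀ P → Vector Carrier (arity L P) → ⟦ bound L P ⟧
    pred dist    x = d (x zero) (x (suc zero)) , d-bounded _ _
    pred (rel R) x = relation R x

  -- For nonempty spaces, a countable dense set is the range of a sequence.
  Separable : ∀ {L} → Structure L → Set
  Separable A = Σ[ s ∈ (ℕ → Carrier) ] ∀ x ε → 0# < ε → ∃[ n ] d (s n) x < ε
    where open Structure A using (Carrier; d)

  record Isomorphism {L : Signature} (A B : Structure L) : Set where
    open Signature L
    private
      module A = Structure A
      module B = Structure B
    field
      to          : A.Carrier → B.Carrier
      isBijection : IsBijection A._≈ₛ_ B._≈ₛ_ to
      fun-pres    : ∀ F x → to (A.fun F x) B.≈ₛ B.fun F (to ∘ x)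
      pred-pres   : ∀ P x → proj₁ (A.pred P x) ≈ proj₁ (B.pred P (to ∘ x))

  module _ (L : Signature) where
    open Signature L

    data Term (n : ℕ) : Set where
      var : Fin n → Term n
      app : ∀ F → Vector (Term n) (fun-arity F) → Term n

    record Atomic (n : ℕ) : Set where
      constructor atom
      field
        symbol    : PredSym L
        arguments : Vector (Term n) (arity L symbol)

  module _ {L : Signature} where
    open Signature L

    Δᵀ : ∀ {n} → Term L n → Vector ℝ≥0 n → ℝ≥0
    Δᵀ (var i)   δ = δ i
    Δᵀ (app F τ) δ = Modulus.Δ (fun-mod F) (λ i → Δᵀ (τ i) δ)

    Δᴬ : ∀ {n} → Atomic L n → Vector ℝ≥0 n → ℝ≥0
    Δᴬ (atom P τ) δ = Δᴾ L P (λ i → Δᵀ (τ i) δ)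

    boundᴬ : ∀ {n} → Atomic L n → Interval
    boundᴬ (atom P _) = bound L P

    module _ (A : Structure L) where
      open Structure A

      evalᵀ : ∀ {n} → Term L n → Vector Carrier n → Carrier
      evalᵀ (var i)   a = a i
      evalᵀ (app F τ) a = fun F (λ i → evalᵀ (τ i) a)

      evalᴬ : ∀ {n} (φ : Atomic L n) → Vector Carrier n → ⟦ boundᴬ φ ⟧
      evalᴬ (atom P τ) a = pred P (λ i → evalᵀ (τ i) a)

  Box : ∀ {m} → Vector Interval m → Set
  Box I = ∀ i → ⟦ I i ⟧

  record Basic (L : Signature) (n : ℕ) : Set where
    field
      {size}     : ℕ
      atoms      : Vector (Atomic L n) size
      f          : Box (boundᴬ ∘ atoms) → Real
      continuous : ∀ x ε → 0# < ε → ∃[ η ] 0# < η ×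
                   (∀ y → (∀ i → ∣ proj₁ (x i) - proj₁ (y i) ∣ < η) → ∣ f x - f y ∣ < ε)

    Δᶠ : Vector ℝ≥0 size → [0,∞]
    Δᶠ δ = sup {I = Σ[ x ∈ Box (boundᴬ ∘ atoms) ] Σ[ y ∈ Box (boundᴬ ∘ atoms) ]
                      (∀ i → ∣ proj₁ (x i) - proj₁ (y i) ∣ ≤ val (δ i))}
               (λ (x , y , _) → fin ∣ f x - f y ∣⁺)

    Δᴮ : Vector ℝ≥0 n → [0,∞]
    Δᴮ δ = Δᶠ (λ i → Δᴬ (atoms i) δ)

    evalᴮ : (A : Structure L) → Vector (Structure.Carrier A) n → Real
    evalᴮ A a = f (λ i → evalᴬ A (atoms i) a)

  open Basic public using (Δᴮ; evalᴮ)

  -- In universal₁ and universal₂, j is the number of leading zeros, so n = j + k.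
  record IsUniversal (L : Signature) (Ω : WeakModulus) : Set where
    field
      universal₁ : ∀ {k} (φ : Atomic L k) → ∃[ j ] ∀ (δ : Vector ℝ≥0 k) →
                   fin (Δᴬ φ δ) ≤∞ Ω ↾ (replicate j 0⁺ ++ δ)
      universal₂ : ∀ k (M : ℝ≥0) → 0# < val M → ∃[ j ] ∀ (δ : Vector ℝ≥0 k) →
                   M ·∞ (Ω ↾ δ) ≤∞ Ω ↾ (replicate j 0⁺ ++ δ)
      universal₃ : ∀ {k n} (δ : Vector ℝ≥0 k) (γ : Vector ℝ≥0 n) →
                   (Ω ↾ δ) +∞ (Ω ↾ γ) ≤∞ Ω ↾ (δ ++ γ)
      universal₄ : ShiftIncreasing Ω

  dist^ : ∀ {L} (Ω : WeakModulus) (B : Structure L) {n} (a b : Vector (Structure.Carrier B) n) → [0,∞]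
  dist^ Ω B a b = Ω ↾ (λ i → Structure.d⁺ B (a i) (b i))

  infixl 5 _∷ʳ_
  _∷ʳ_ : ∀ {X : Set} {n} → Vector X n → X → Vector X (suc n)
  _∷ʳ_ {n = n} a c = insertAt a (fromℕ n) c

  module BackAndForth {L : Signature} (Ω : WeakModulus) (A B : Structure L) where
    private
      module A = Structure A
      module B = Structure B

    PseudoDistance : Set
    PseudoDistance = ∀ {n} → Vector A.Carrier n → Vector B.Carrier n → [0,∞]

    r-zero : PseudoDistance
    r-zero {n} a b =
      sup {I = Σ[ φ ∈ Basic L n ] (∀ δ → Δᴮ φ δ ≤∞ Ω ↾ δ)}
          (λ (φ , _) → fin ∣ evalᴮ φ A a - evalᴮ φ B b ∣⁺)

    r-suc : PseudoDistance → PseudoDistance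
    r-suc r a b =
      sup {I = A.Carrier × B.Carrier} λ (c , d) →
      inf {I = A.Carrier × B.Carrier} λ (c′ , d′) →
      max∞ (r (a ∷ʳ c) (b ∷ʳ d′)) (r (a ∷ʳ c′) (b ∷ʳ d))

    -- r-below α p is r at the ordinal below α that is indexed by p, so the limit
    -- clause is a supremum over all smaller ordinals.
    mutual
      r : Ord → PseudoDistance
      r zero      = r-zero
      r (suc α)   = r-suc (r α)
      r (lim I f) a b = sup {I = Below (lim I f)} λ (i , p) → r-below (f i) p a b

      r-below : (α : Ord) → Below α → PseudoDistance
      r-below (suc α)   nothing  = r α
      r-below (suc α)   (just p) = r-below α p
      r-below (lim I f) (i , p)  = r-below (f i) p

    -- Ordinals denoted in Ord suffice: carriers are in Set, so the r α stabilise there.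
    r∞ : PseudoDistance
    r∞ a b = sup {I = Σ[ α ∈ Ord ] IsOrdinal α} λ (α , _) → r α a b

module Submission where

open import Algebra.Bundles using (CommutativeRing)
import Algebra.Construct.NaturalChoice.Max as Max
import Algebra.Construct.NaturalChoice.Min as Min
import Algebra.Properties.AbelianGroup as AbelianGroupProperties
import Algebra.Properties.CommutativeSemigroup as CommutativeSemigroupProperties
import Algebra.Properties.Ring as RingProperties
open import Defs
open import Axiom.ExcludedMiddle using (ExcludedMiddle)
open import Data.Fin.Base as Fin using (Fin; zero; suc; toℕ; fromℕ; inject₁)
open import Data.Fin.Properties using (toℕ-inject₁; toℕ-fromℕ; toℕ<n)
open import Data.Maybe.Base using (Maybe; just; nothing)
open import Data.Nat.Base as ℕ using (ℕ; zero; suc; z≤n; s≤s)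
import Data.Nat.Properties as ℕₚ
open import Data.Product.Base using (∃-syntax; Σ-syntax; _×_; _,_; proj₁; proj₂)
open import Data.Sum.Base as Sum using (_⊎_; inj₁; inj₂)
open import Data.Unit.Base using (tt)
open import Data.Vec.Functional using (Vector; []; _∷_; _++_; replicate; tail)
open import Data.Vec.Functional.Properties using (insertAt-lookup)
open import Data.Vec.Functional.Relation.Unary.All.Properties using (++⁺)
open import Function.Base using (_∘_)
open import Function.Metric.Structures using (IsGeneralMetric)
open import Function.Structures using (IsBijection)
open import Relation.Binary.Bundles using (TotalOrder)
import Relation.Binary.Construct.NonStrictToStrict as Strict
open import Relation.Binary.Definitions using (tri<; tri≈; tri>)
open import Relation.Binary.PropositionalEquality.Core using (_≡_; _≢_; refl; sym; trans; cong; cong₂; subst)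
import Relation.Binary.Reasoning.PartialOrder as PartialOrderReasoning
open import Relation.Nullary using (¬_; Dec; yes; no; contradiction)
open import Relation.Nullary.Decidable using (decidable-stable)

-- For an isomorphism f, induction on α gives r α v w ≤ d^Ω(f v, w): each back-and-forth
-- move is answered by f or its inverse. Conversely, r∞ is attained at a single ordinal,
-- because the true statements r∞ a b > t form a set and each is witnessed by an ordinal.
-- Hence r∞ < t is preserved by suitable one-point extensions, and a back-and-forth
-- construction starting at (v, w) yields sequences c in A and d in B, with every point
-- of a dense sequence recurring infinitely often, whose initial tuples all satisfy r∞ < t.
-- A multiple M φ of an atomic formula respects Ω in sufficiently late variables, so the
-- values of φ on late subtuples of c and d differ by at most t / M. Therefore the cluster
-- points of the pairs (c i , d i) form the graph of an isomorphism f. Finally, take late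
-- i_q with c i_q close to v_q. The formula Ω(d(x_q, x_{i_q}))_q respects Ω by universal₃
-- and universal₄, it is nearly 0 in A, and it nearly bounds d^Ω(f v, w) in B.
module _ (em : ∀ {ℓ} → ExcludedMiddle ℓ) (ℝ : CompleteOrderedField) where

  open Theory em ℝ
  private
    module R = CompleteOrderedField ℝ
    module T = TotalOrder R.totalOrder
    module S = Strict _≈_ _≤_
    module + = AbelianGroupProperties (CommutativeRing.+-abelianGroup R.commutativeRing)
    module +ₛ = CommutativeSemigroupProperties R.+-commutativeSemigroup
    module *ₚ = RingProperties R.ring
    module ≤-Reasoning = PartialOrderReasoning T.poset

  -- Complete ordered fields

  by-contradiction : ∀ {ℓ} {P : Set ℓ} → ¬ ¬ P → P
  by-contradiction = decidable-stable em

  ≡⇒≤ : ∀ {x y} → x ≡ y → x ≤ y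
  ≡⇒≤ = T.reflexive ∘ R.reflexive

  ≰⇒> : ∀ {x y} → ¬ x ≤ y → y < x
  ≰⇒> = S.≰⇒> R.sym T.reflexive T.total

  <⇒≱ : ∀ {x y} → x < y → ¬ y ≤ x
  <⇒≱ = S.<⇒≱ T.antisym

  <-≤-trans : ∀ {x y z} → x < y → y ≤ z → x < z
  <-≤-trans = S.<-≤-trans R.sym T.trans T.antisym T.≤-respʳ-≈

  ≤-<-trans : ∀ {x y z} → x ≤ y → y < z → x < z
  ≤-<-trans = S.≤-<-trans T.trans T.antisym T.≤-respˡ-≈

  +-monoʳ-≤ : ∀ z {x y} → x ≤ y → z + x ≤ z + y
  +-monoʳ-≤ z x≤y = T.≤-respˡ-≈ (R.+-comm _ z) (T.≤-respʳ-≈ (R.+-comm _ z) (R.+-monoˡ-≤ z x≤y))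

  +-mono-≤ : ∀ {x y u v} → x ≤ y → u ≤ v → x + u ≤ y + v
  +-mono-≤ {y = y} {u} x≤y u≤v = T.trans (R.+-monoˡ-≤ u x≤y) (+-monoʳ-≤ y u≤v)

  +-cancelʳ-≤ : ∀ z {x y} → x + z ≤ y + z → x ≤ y
  +-cancelʳ-≤ z {x} {y} le =
    T.≤-respˡ-≈ (+.//-rightDividesʳ z x) (T.≤-respʳ-≈ (+.//-rightDividesʳ z y) (R.+-monoˡ-≤ (- z) le))

  +-cancelˡ-≤ : ∀ z {x y} → z + x ≤ z + y → x ≤ y
  +-cancelˡ-≤ z le =
    +-cancelʳ-≤ z (T.≤-respˡ-≈ (R.+-comm z _) (T.≤-respʳ-≈ (R.+-comm z _) le))

  x≤x+y : ∀ {x y} → 0# ≤ y → x ≤ x + y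
  x≤x+y {x} 0≤y = T.≤-respˡ-≈ (R.+-identityʳ x) (+-monoʳ-≤ x 0≤y)

  x≤y+x : ∀ {x y} → 0# ≤ y → x ≤ y + x
  x≤y+x 0≤y = T.≤-respʳ-≈ (R.+-comm _ _) (x≤x+y 0≤y)

  +-pos : ∀ {x y} → 0# < x → 0# ≤ y → 0# < x + y
  +-pos 0<x 0≤y = <-≤-trans 0<x (x≤x+y 0≤y)

  x<x+y : ∀ {x y} → 0# < y → x < x + y
  x<x+y {x} 0<y = ≰⇒> λ le →
    <⇒≱ 0<y (+-cancelˡ-≤ x (T.≤-respʳ-≈ (R.sym (R.+-identityʳ x)) le))

  neg-mono-≤ : ∀ {x y} → x ≤ y → - y ≤ - x
  neg-mono-≤ {x} {y} x≤y = +-cancelʳ-≤ x (begin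
    - y + x ≤⟨ +-monoʳ-≤ (- y) x≤y ⟩
    - y + y ≈⟨ R.-‿inverseˡ y ⟩
    0#      ≈⟨ R.-‿inverseˡ x ⟨
    - x + x ∎)
    where open ≤-Reasoning

  *-monoʳ-≤ : ∀ {c} → 0# ≤ c → ∀ {x y} → x ≤ y → c * x ≤ c * y
  *-monoʳ-≤ {c} 0≤c {x} {y} x≤y = +-cancelʳ-≤ (- (c * x)) (begin
    c * x - c * x     ≈⟨ R.-‿inverseʳ (c * x) ⟩
    0#                ≤⟨ R.*-nonneg 0≤c 0≤y-x ⟩
    c * (y - x)       ≈⟨ R.distribˡ c y (- x) ⟩
    c * y + c * - x   ≈⟨ R.+-congˡ (*ₚ.-‿distribʳ-* c x) ⟨
    c * y - c * x     ∎)
    where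
    open ≤-Reasoning
    0≤y-x : 0# ≤ y - x
    0≤y-x = T.≤-respˡ-≈ (R.-‿inverseʳ x) (R.+-monoˡ-≤ (- x) x≤y)

  -- Otherwise `- 1#` is nonnegative, and so is its square, which equals 1.
  0≤1 : 0# ≤ 1#
  0≤1 with T.total 0# 1#
  ... | inj₁ 0≤1 = 0≤1
  ... | inj₂ 1≤0 = T.≤-respʳ-≈ square (R.*-nonneg 0≤-1 0≤-1)
    where
    0≤-1 : 0# ≤ - 1#
    0≤-1 = T.≤-respˡ-≈ +.ε⁻¹≈ε (neg-mono-≤ 1≤0)
    square : - 1# * - 1# ≈ 1#
    square = R.trans (*ₚ.-1*x≈-x (- 1#)) (+.⁻¹-involutive 1#)

  0<1 : 0# < 1#
  0<1 = 0≤1 , R.0≉1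

  pos-inverse : ∀ {x} → 0# < x → ∃[ y ] 0# ≤ y × x * y ≈ 1#
  pos-inverse {x} (0≤x , 0≉x) with R.inverse x (0≉x ∘ R.sym)
  ... | y , xy≈1 with T.total 0# y
  ...   | inj₁ 0≤y = y , 0≤y , xy≈1
  ...   | inj₂ y≤0 = contradiction
    (T.≤-respˡ-≈ xy≈1 (T.≤-respʳ-≈ (R.zeroʳ x) (*-monoʳ-≤ 0≤x y≤0))) (<⇒≱ 0<1)

  *-cancelˡ-≤ : ∀ {c} → 0# < c → ∀ {x y} → c * x ≤ c * y → x ≤ y
  *-cancelˡ-≤ {c} 0<c {x} {y} cx≤cy =
    let i , 0≤i , ci≈1 = pos-inverse 0<c
        undo : ∀ z → i * (c * z) ≈ z
        undo z = R.trans (R.sym (R.*-assoc i c z))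
                   (R.trans (R.*-congʳ (R.trans (R.*-comm i c) ci≈1)) (R.*-identityˡ z))
    in T.≤-respˡ-≈ (undo x) (T.≤-respʳ-≈ (undo y) (*-monoʳ-≤ 0≤i cx≤cy))

  divide : ∀ {c x} → 0# < c → 0# < x → ∃[ y ] 0# < y × c * y ≈ x
  divide {c} {x} 0<c 0<x =
    let i , 0≤i , ci≈1 = pos-inverse 0<c
        c*ix≈x : c * (i * x) ≈ x
        c*ix≈x = R.trans (R.sym (R.*-assoc c i x)) (R.trans (R.*-congʳ ci≈1) (R.*-identityˡ x))
    in i * x , ≰⇒> (λ ix≤0 → <⇒≱ 0<x
         (T.≤-respˡ-≈ c*ix≈x (T.≤-respʳ-≈ (R.zeroʳ c) (*-monoʳ-≤ (proj₁ 0<c) ix≤0)))) , c*ix≈x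

  halve : ∀ {x} → 0# < x → ∃[ y ] 0# < y × y + y ≈ x
  halve {x} 0<x =
    let y , 0<y , 2y≈x = divide (+-pos 0<1 0≤1) 0<x
    in y , 0<y , R.trans (R.sym (R.+-cong (R.*-identityˡ y) (R.*-identityˡ y)))
                   (R.trans (R.sym (R.distribʳ y 1# 1#)) 2y≈x)

  half : ∀ {x} → 0# < x → Real
  half 0<x = proj₁ (halve 0<x)

  0<half : ∀ {x} (0<x : 0# < x) → 0# < half 0<x
  0<half 0<x = proj₁ (proj₂ (halve 0<x))

  half+half : ∀ {x} (0<x : 0# < x) → half 0<x + half 0<x ≈ x
  half+half 0<x = proj₂ (proj₂ (halve 0<x))

  half≤ : ∀ {x} (0<x : 0# < x) → half 0<x ≤ x
  half≤ 0<x = T.≤-respʳ-≈ (half+half 0<x) (x≤x+y (proj₁ (0<half 0<x)))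

  half< : ∀ {x} (0<x : 0# < x) → half 0<x < x
  half< 0<x = <-≤-trans (x<x+y (0<half 0<x)) (T.reflexive (half+half 0<x))

  -- If `y < x`, taking half of `x - y` for ε gives `y + h + h ≤ y + h`, against `0 < h`.
  ≤-by-ε : ∀ {x y} → (∀ ε → 0# < ε → x ≤ y + ε) → x ≤ y
  ≤-by-ε {x} {y} x≤y+ε = by-contradiction λ x≰y →
    let y<x = ≰⇒> x≰y
        0<x-y : 0# < x - y
        0<x-y = ≰⇒> λ le → x≰y (+-cancelʳ-≤ (- y) (T.≤-respʳ-≈ (R.sym (R.-‿inverseʳ y)) le))
        h = half 0<x-y
    in <⇒≱ (0<half 0<x-y) (+-cancelˡ-≤ (y + h) (begin
      y + h + h        ≈⟨ R.+-assoc y h h ⟩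
      y + (h + h)      ≈⟨ R.+-congˡ (half+half 0<x-y) ⟩
      y + (x - y)      ≈⟨ R.+-comm y (x - y) ⟩
      (x - y) + y      ≈⟨ +.//-rightDividesˡ y x ⟩
      x                ≤⟨ x≤y+ε h (0<half 0<x-y) ⟩
      y + h            ≈⟨ R.+-identityʳ (y + h) ⟨
      (y + h) + 0#     ∎))
    where open ≤-Reasoning

  x≤∣x∣ : ∀ x → x ≤ ∣ x ∣
  x≤∣x∣ x = Max.x≤x⊔y R.totalOrder x (- x)

  -x≤∣x∣ : ∀ x → - x ≤ ∣ x ∣
  -x≤∣x∣ x = Max.x≤y⊔x R.totalOrder x (- x)

  ∣x∣≤ : ∀ {x c} → x ≤ c → - x ≤ c → ∣ x ∣ ≤ c
  ∣x∣≤ {x} = Max.⊔-lub R.totalOrder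

  ∣x∣≤x : ∀ {x} → 0# ≤ x → ∣ x ∣ ≤ x
  ∣x∣≤x 0≤x = ∣x∣≤ T.refl (T.trans (T.≤-respʳ-≈ +.ε⁻¹≈ε (neg-mono-≤ 0≤x)) 0≤x)

  ∣x-y∣≤ : ∀ {x y c} → x ≤ y + c → y ≤ x + c → ∣ x - y ∣ ≤ c
  ∣x-y∣≤ {x} {y} {c} x≤y+c y≤x+c =
    ∣x∣≤ (move x y x≤y+c) (T.≤-respˡ-≈ (R.sym (+.⁻¹-anti-homo‿- x y)) (move y x y≤x+c))
    where
    move : ∀ x y → x ≤ y + c → x - y ≤ c
    move x y le = T.≤-respʳ-≈ (+.xyx⁻¹≈y y c) (R.+-monoˡ-≤ (- y) le)

  ∣x-y∣≤⇒x≤ : ∀ {x y c} → ∣ x - y ∣ ≤ c → x ≤ y + c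
  ∣x-y∣≤⇒x≤ {x} {y} {c} le = begin
    x            ≈⟨ +.//-rightDividesˡ y x ⟨
    (x - y) + y  ≤⟨ R.+-monoˡ-≤ y (T.trans (x≤∣x∣ (x - y)) le) ⟩
    c + y        ≈⟨ R.+-comm c y ⟩
    y + c        ∎
    where open ≤-Reasoning

  ∣x-y∣≤⇒y≤ : ∀ {x y c} → ∣ x - y ∣ ≤ c → y ≤ x + c
  ∣x-y∣≤⇒y≤ {x} {y} {c} le = begin
    y            ≈⟨ +.//-rightDividesˡ x y ⟨
    (y - x) + x  ≈⟨ R.+-congʳ (+.⁻¹-anti-homo‿- x y) ⟨
    - (x - y) + x ≤⟨ R.+-monoˡ-≤ x (T.trans (-x≤∣x∣ (x - y)) le) ⟩
    c + x        ≈⟨ R.+-comm c x ⟩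
    x + c        ∎
    where open ≤-Reasoning

  ∣-∣-sym : ∀ {x y c} → ∣ x - y ∣ ≤ c → ∣ y - x ∣ ≤ c
  ∣-∣-sym le = ∣x-y∣≤ (∣x-y∣≤⇒y≤ le) (∣x-y∣≤⇒x≤ le)

  ∣-∣-trans : ∀ {x y z c c′} → ∣ x - y ∣ ≤ c → ∣ y - z ∣ ≤ c′ → ∣ x - z ∣ ≤ c + c′
  ∣-∣-trans {c = c} {c′} p q = ∣x-y∣≤
    (T.trans (∣x-y∣≤⇒x≤ p) (T.trans (R.+-monoˡ-≤ c (∣x-y∣≤⇒x≤ q))
      (T.reflexive (R.trans (R.+-assoc _ c′ c) (R.+-congˡ (R.+-comm c′ c))))))
    (T.trans (∣x-y∣≤⇒y≤ q) (T.trans (R.+-monoˡ-≤ c′ (∣x-y∣≤⇒y≤ p))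
      (T.reflexive (R.+-assoc _ c c′))))

  ≈⇒∣-∣≤ : ∀ {x y c} → x ≈ y → 0# ≤ c → ∣ x - y ∣ ≤ c
  ≈⇒∣-∣≤ x≈y 0≤c = ∣x-y∣≤ (T.trans (T.reflexive x≈y) (x≤x+y 0≤c))
                         (T.trans (T.reflexive (R.sym x≈y)) (x≤x+y 0≤c))

  ∣-∣≤ε⇒≈ : ∀ {x y} → (∀ ε → 0# < ε → ∣ x - y ∣ ≤ ε) → x ≈ y
  ∣-∣≤ε⇒≈ le = T.antisym (≤-by-ε λ ε 0<ε → ∣x-y∣≤⇒x≤ (le ε 0<ε))
                         (≤-by-ε λ ε 0<ε → ∣x-y∣≤⇒y≤ (le ε 0<ε))

  ∣-∣≤0⇒≈ : ∀ {x y} → ∣ x - y ∣ ≤ 0# → x ≈ y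
  ∣-∣≤0⇒≈ le = ∣-∣≤ε⇒≈ λ ε 0<ε → T.trans le (proj₁ 0<ε)

  ∣x∣≤∣y∣+ : ∀ {x y c} → ∣ x - y ∣ ≤ c → ∣ x ∣ ≤ ∣ y ∣ + c
  ∣x∣≤∣y∣+ {x} {y} {c} le = ∣x∣≤
    (T.trans (∣x-y∣≤⇒x≤ le) (R.+-monoˡ-≤ c (x≤∣x∣ y)))
    (+-cancelʳ-≤ x (begin
      - x + x            ≈⟨ R.-‿inverseˡ x ⟩
      0#                 ≈⟨ R.-‿inverseˡ y ⟨
      - y + y            ≤⟨ +-mono-≤ (-x≤∣x∣ y) (∣x-y∣≤⇒y≤ le) ⟩
      ∣ y ∣ + (x + c)    ≈⟨ R.+-congˡ (R.+-comm x c) ⟩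
      ∣ y ∣ + (c + x)    ≈⟨ R.+-assoc _ c x ⟨
      (∣ y ∣ + c) + x    ∎))
    where open ≤-Reasoning

  *-∣-∣ : ∀ {M x y c} → 0# ≤ M → ∣ x - y ∣ ≤ c → ∣ M * x - M * y ∣ ≤ M * c
  *-∣-∣ {M} 0≤M le = ∣x-y∣≤ (scale (∣x-y∣≤⇒x≤ le)) (scale (∣x-y∣≤⇒y≤ le))
    where
    scale : ∀ {x y c} → x ≤ y + c → M * x ≤ M * y + M * c
    scale le = T.≤-respʳ-≈ (R.distribˡ M _ _) (*-monoʳ-≤ 0≤M le)

  *-∣-∣-cancel : ∀ {M x y c} → 0# < M → ∣ M * x - M * y ∣ ≤ M * c → ∣ x - y ∣ ≤ c
  *-∣-∣-cancel {M} 0<M le = ∣x-y∣≤ (unscale (∣x-y∣≤⇒x≤ le)) (unscale (∣x-y∣≤⇒y≤ le))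
    where
    unscale : ∀ {x y c} → M * x ≤ M * y + M * c → x ≤ y + c
    unscale le = *-cancelˡ-≤ 0<M (T.≤-respʳ-≈ (R.sym (R.distribˡ M _ _)) le)

  halves : ℕ → Σ[ x ∈ Real ] 0# < x
  halves zero    = 1# , 0<1
  halves (suc n) = half (proj₂ (halves n)) , 0<half (proj₂ (halves n))

  2⁻ : ℕ → Real
  2⁻ n = proj₁ (halves n)

  2⁻-pos : ∀ n → 0# < 2⁻ n
  2⁻-pos n = proj₂ (halves n)

  2⁻-antitone : ∀ {m n} → m ℕ.≤ n → 2⁻ n ≤ 2⁻ m
  2⁻-antitone m≤n = go (ℕₚ.≤⇒≤′ m≤n)
    where
    go : ∀ {m n} → m ℕ.≤′ n → 2⁻ n ≤ 2⁻ m
    go (ℕ.≤′-reflexive refl) = T.refl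
    go (ℕ.≤′-step {n} m≤′n) = T.trans (half≤ (2⁻-pos n)) (go m≤′n)

  -- The reals below every 2⁻ n are closed under addition, so none is positive: their
  -- supremum g would satisfy g + ε ≤ g.
  2⁻-null : ∀ ε → 0# < ε → ∃[ n ] 2⁻ n < ε
  2⁻-null ε 0<ε = by-contradiction λ none →
    let Small : Real → Set
        Small x = ∀ n → x ≤ 2⁻ n
        ε-small : Small ε
        ε-small n = by-contradiction λ ε≰ → none (n , ≰⇒> ε≰)
        g , upper , least = R.lub Small (ε , ε-small) (1# , λ x small → small 0)
        small+ε : ∀ x → Small x → Small (x + ε)
        small+ε x small n = T.≤-respʳ-≈ (half+half (2⁻-pos n)) (+-mono-≤ (small (suc n)) (ε-small (suc n)))
        move : ∀ x → x + ε ≤ g → x ≤ g - ε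
        move x le = T.≤-respˡ-≈ (+.//-rightDividesʳ ε x) (R.+-monoˡ-≤ (- ε) le)
        g≤g-ε = least (g - ε) λ x small → move x (upper (x + ε) (small+ε x small))
    in <⇒≱ (x<x+y 0<ε) (T.≤-respʳ-≈ (+.//-rightDividesˡ ε g) (R.+-monoˡ-≤ ε g≤g-ε))

  min-pos : ∀ {x y} → 0# < x → 0# < y → ∃[ z ] 0# < z × z ≤ x × z ≤ y
  min-pos {x} {y} 0<x 0<y with T.total x y
  ... | inj₁ x≤y = x , 0<x , T.refl , x≤y
  ... | inj₂ y≤x = y , 0<y , y≤x , T.refl

  -- Extended nonnegative reals and moduli

  -- _≤∞_ is defined by recursion, so its arguments cannot be inferred; those of _≼_ can.
  infix 4 _≼_
  record _≼_ (x y : [0,∞]) : Set where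
    constructor wrap
    field unwrap : x ≤∞ y
  open _≼_

  ≼-refl : ∀ {x} → x ≼ x
  ≼-refl {fin x} = wrap T.refl
  ≼-refl {∞}     = wrap tt

  ≼-reflexive : ∀ {x y} → x ≡ y → x ≼ y
  ≼-reflexive refl = ≼-refl

  ≼-trans : ∀ {x y z} → x ≼ y → y ≼ z → x ≼ z
  ≼-trans {z = ∞}                      _        _        = wrap tt
  ≼-trans {x = fin _} {fin _} {fin _} (wrap p) (wrap q) = wrap (T.trans p q)

  ≼-antisym : ∀ {x y} → x ≼ y → y ≼ x → x ≈∞ y
  ≼-antisym {fin _} {fin _} (wrap p) (wrap q) = T.antisym p q
  ≼-antisym {∞}     {∞}     _        _        = tt

  ≈∞⇒≼ : ∀ x y → x ≈∞ y → x ≼ y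
  ≈∞⇒≼ (fin _) (fin _) x≈y = wrap (T.reflexive x≈y)
  ≈∞⇒≼ ∞       ∞       _   = wrap tt

  ≈∞-sym : ∀ x y → x ≈∞ y → y ≈∞ x
  ≈∞-sym (fin _) (fin _) = R.sym
  ≈∞-sym ∞       ∞     _ = tt

  ≼-total : ∀ x y → x ≼ y ⊎ y ≼ x
  ≼-total (fin x) (fin y) = Sum.map wrap wrap (T.total (val x) (val y))
  ≼-total x       ∞       = inj₁ (wrap tt)
  ≼-total ∞       (fin _) = inj₂ (wrap tt)

  ⋠⇒≽ : ∀ {x y} → ¬ x ≼ y → y ≼ x
  ⋠⇒≽ {x} {y} x⋠y with ≼-total x y
  ... | inj₁ x≼y = contradiction x≼y x⋠y
  ... | inj₂ y≼x = y≼x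

  ⋠⇒>∞ : ∀ {x y} → ¬ x ≼ y → y <∞ x
  ⋠⇒>∞ {x} {y} x⋠y = unwrap (⋠⇒≽ x⋠y) , λ y≈x → x⋠y (≈∞⇒≼ x y (≈∞-sym y x y≈x))

  <∞⇒⋡ : ∀ {x y} → x <∞ y → ¬ y ≼ x
  <∞⇒⋡ (x≤y , x≉y) y≼x = x≉y (≼-antisym (wrap x≤y) y≼x)

  max∞-upperˡ : ∀ x y → x ≼ max∞ x y
  max∞-upperˡ (fin x) (fin y) = wrap (Max.x≤x⊔y R.totalOrder (val x) (val y))
  max∞-upperˡ (fin _) ∞       = wrap tt
  max∞-upperˡ ∞       _       = wrap tt

  max∞-upperʳ : ∀ x y → y ≼ max∞ x y
  max∞-upperʳ (fin x) (fin y) = wrap (Max.x≤y⊔x R.totalOrder (val x) (val y))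
  max∞-upperʳ (fin _) ∞       = wrap tt
  max∞-upperʳ ∞       (fin _) = wrap tt
  max∞-upperʳ ∞       ∞       = wrap tt

  max∞-lub : ∀ {x y z} → x ≼ z → y ≼ z → max∞ x y ≼ z
  max∞-lub {z = ∞}                     _          _          = wrap tt
  max∞-lub {fin x} {fin y} {fin z} (wrap x≤z) (wrap y≤z) = wrap (Max.⊔-lub R.totalOrder x≤z y≤z)

  +∞-mono : ∀ {x y u v} → x ≼ y → u ≼ v → (x +∞ u) ≼ (y +∞ v)
  +∞-mono {y = ∞}                                _          _          = wrap tt
  +∞-mono {y = fin _} {v = ∞}                    _          _          = wrap tt
  +∞-mono {fin _} {fin _} {fin _} {fin _} (wrap x≤y) (wrap u≤v) = wrap (+-mono-≤ x≤y u≤v)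

  ≼-by-ε : ∀ {x y} → (∀ ε (0<ε : 0# < ε) → x ≼ fin (y +⁺ (ε ,⁺ proj₁ 0<ε))) → x ≼ fin y
  ≼-by-ε {fin x} x≼y+ε = wrap (≤-by-ε λ ε 0<ε → unwrap (x≼y+ε ε 0<ε))
  ≼-by-ε {∞}     x≼y+ε = contradiction (unwrap (x≼y+ε 1# 0<1)) λ ()

  infix 4 _⊑_
  _⊑_ : {I : Set} → (I → ℝ≥0) → (I → ℝ≥0) → Set
  δ ⊑ δ′ = ∀ i → val (δ i) ≤ val (δ′ i)

  difference : {I : Set} {δ δ′ : I → ℝ≥0} → δ ⊑ δ′ → I → ℝ≥0
  difference {δ = δ} {δ′} δ⊑δ′ i =
    (val (δ′ i) - val (δ i)) ,⁺ T.≤-respˡ-≈ (R.-‿inverseʳ (val (δ i))) (R.+-monoˡ-≤ (- val (δ i)) (δ⊑δ′ i))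

  ⊕-difference : {I : Set} {δ δ′ : I → ℝ≥0} (δ⊑δ′ : δ ⊑ δ′) → ∀ i →
                 val ((δ ⊕ difference {δ = δ} {δ′} δ⊑δ′) i) ≈ val (δ′ i)
  ⊕-difference {δ = δ} {δ′} _ i =
    R.trans (R.sym (R.+-assoc (val (δ i)) (val (δ′ i)) (- val (δ i))))
      (+.xyx⁻¹≈y (val (δ i)) (val (δ′ i)))

  ≈⇒∣-∣< : ∀ {x y η} → x ≈ y → 0# < η → ∣ x - y ∣ < η
  ≈⇒∣-∣< x≈y 0<η = ≤-<-trans (≈⇒∣-∣≤ x≈y T.refl) 0<η

  module _ {n} (M : Modulus n) where
    open Modulus M

    -- Nothing in `Modulus` states that `Δ` respects the equality of the field. Continuity implies
    -- it: tuples that agree are within every η of each other.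
    Modulus-cong : ∀ {δ δ′} → (∀ i → val (δ i) ≈ val (δ′ i)) → val (Δ δ) ≈ val (Δ δ′)
    Modulus-cong {δ} {δ′} δ≈δ′ = ∣-∣≤ε⇒≈ λ ε 0<ε →
      let η , 0<η , near = continuous δ ε 0<ε
      in proj₁ (near δ′ λ i → ≈⇒∣-∣< (δ≈δ′ i) 0<η)

    -- `mono` compares `δ` only with sums `δ ⊕ δ′`, so the larger tuple is first written, up to
    -- `_≈_`, as such a sum.
    Modulus-mono : ∀ {δ δ′} → δ ⊑ δ′ → val (Δ δ) ≤ val (Δ δ′)
    Modulus-mono {δ} {δ′} δ⊑δ′ =
      T.≤-respʳ-≈ (Modulus-cong (⊕-difference {δ = δ} {δ′} δ⊑δ′)) (mono δ (difference {δ = δ} {δ′} δ⊑δ′))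

  -- Increasing index maps and padded tuples

  Increasing : (ℕ → ℕ) → Set
  Increasing ι = ∀ p → ι p ℕ.< ι (suc p)

  module _ {ι : ℕ → ℕ} (inc : Increasing ι) where

    Increasing⇒mono-≤ : ∀ {p q} → p ℕ.≤ q → ι p ℕ.≤ ι q
    Increasing⇒mono-≤ p≤q = go (ℕₚ.≤⇒≤′ p≤q)
      where
      go : ∀ {p q} → p ℕ.≤′ q → ι p ℕ.≤ ι q
      go (ℕ.≤′-reflexive refl) = ℕₚ.≤-refl
      go (ℕ.≤′-step {q} p≤′q)  = ℕₚ.≤-trans (go p≤′q) (ℕₚ.<⇒≤ (inc q))

    Increasing⇒mono-< : ∀ p q → p ℕ.< q → ι p ℕ.< ι q
    Increasing⇒mono-< p q p<q = ℕₚ.<-≤-trans (inc p) (Increasing⇒mono-≤ p<q)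

    Increasing⇒injective : ∀ {p q} → ι p ≡ ι q → p ≡ q
    Increasing⇒injective {p} {q} eq with ℕₚ.<-cmp p q
    ... | tri≈ _ p≡q _ = p≡q
    ... | tri< p<q _ _ = contradiction eq (ℕₚ.<⇒≢ (Increasing⇒mono-< p q p<q))
    ... | tri> _ _ q<p = contradiction (sym eq) (ℕₚ.<⇒≢ (Increasing⇒mono-< q p q<p))

  infixr 5 _◂_
  _◂_ : ∀ {A : Set} → A → (ℕ → A) → ℕ → A
  (x ◂ f) zero    = x
  (x ◂ f) (suc n) = f n

  ◂-increasing : ∀ {i ι} → i ℕ.< ι 0 → Increasing ι → Increasing (i ◂ ι)
  ◂-increasing i<ι₀ inc zero    = i<ι₀
  ◂-increasing i<ι₀ inc (suc p) = inc p

  update-same : ∀ (δ : Sequence) i x → (δ [ i ≔ x ]) i ≡ x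
  update-same δ zero    x = refl
  update-same δ (suc i) x = update-same (δ ∘ suc) i x

  update-other : ∀ (δ : Sequence) i x j → j ≢ i → (δ [ i ≔ x ]) j ≡ δ j
  update-other δ zero    x zero    j≢i = contradiction refl j≢i
  update-other δ zero    x (suc j) j≢i = refl
  update-other δ (suc i) x zero    j≢i = refl
  update-other δ (suc i) x (suc j) j≢i = update-other (δ ∘ suc) i x j (j≢i ∘ cong suc)

  pad-cong : ∀ {n} {xs ys : Vector ℝ≥0 n} → (∀ i → xs i ≡ ys i) → ∀ p → pad xs p ≡ pad ys p
  pad-cong {zero}  eq p       = refl
  pad-cong {suc n} eq zero    = eq zero
  pad-cong {suc n} eq (suc p) = pad-cong (eq ∘ suc) p

  pad-toℕ : ∀ {n} (xs : Vector ℝ≥0 n) i → pad xs (toℕ i) ≡ xs i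
  pad-toℕ xs zero    = refl
  pad-toℕ xs (suc i) = pad-toℕ (tail xs) i

  -- Case distinction for padded tuples: a position lies inside the tuple or in the zero tail. It
  -- spares later comparisons a separate induction on the length.
  pad-elim : ∀ {n} (xs : Vector ℝ≥0 n) (P : ℕ → ℝ≥0 → Set) →
             (∀ i → P (toℕ i) (xs i)) → (∀ p → n ℕ.≤ p → P p 0⁺) → ∀ p → P p (pad xs p)
  pad-elim {zero}  xs P inside outside p       = outside p z≤n
  pad-elim {suc n} xs P inside outside zero    = inside zero
  pad-elim {suc n} xs P inside outside (suc p) =
    pad-elim (tail xs) (P ∘ suc) (inside ∘ suc) (λ q n≤q → outside (suc q) (s≤s n≤q)) p

  pad-mono : ∀ {n} {xs ys : Vector ℝ≥0 n} → xs ⊑ ys → pad xs ⊑ pad ys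
  pad-mono {xs = xs} {ys} xs⊑ys = pad-elim xs (λ p x → val x ≤ val (pad ys p))
    (λ i → T.≤-respʳ-≈ (R.reflexive (cong val (sym (pad-toℕ ys i)))) (xs⊑ys i))
    (λ p _ → nonneg (pad ys p))

  ++-tail : ∀ {m n} (xs : Vector ℝ≥0 (suc m)) (ys : Vector ℝ≥0 n) i →
            (xs ++ ys) (suc i) ≡ (tail xs ++ ys) i
  ++-tail {m} xs ys i with Fin.splitAt m i
  ... | inj₁ _ = refl
  ... | inj₂ _ = refl

  pad-++ʳ : ∀ {m n} (xs : Vector ℝ≥0 m) (ys : Vector ℝ≥0 n) p →
            pad (xs ++ ys) (m ℕ.+ p) ≡ pad ys p
  pad-++ʳ {zero}  xs ys p = refl
  pad-++ʳ {suc m} xs ys p = trans (pad-cong (++-tail xs ys) (m ℕ.+ p)) (pad-++ʳ (tail xs) ys p)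

  pad-++ˡ : ∀ {m n} (xs : Vector ℝ≥0 m) (ys : Vector ℝ≥0 n) {p} → p ℕ.< m →
            pad (xs ++ ys) p ≡ pad xs p
  pad-++ˡ {suc m} xs ys {zero}  _         = refl
  pad-++ˡ {suc m} xs ys {suc p} (s≤s p<m) = trans (pad-cong (++-tail xs ys) p) (pad-++ˡ (tail xs) ys p<m)

  pad-replicate : ∀ m p → pad (replicate m 0⁺) p ≡ 0⁺
  pad-replicate m p = pad-elim (replicate m 0⁺) (λ _ x → x ≡ 0⁺) (λ _ → refl) (λ _ _ → refl) p

  -- Weak moduli

  module WeakModulusProperties (W : WeakModulus) where
    open WeakModulus W

    -- If `Ω δ` exceeded `Ω δ′`, the latter would be a finite `t`, and lower semicontinuity would
    -- keep Ω above `t` on a neighbourhood of `δ`, which contains `δ′`.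
    Ω-cong : ∀ {δ δ′} → (∀ i → val (δ i) ≈ val (δ′ i)) → Ω δ ≼ Ω δ′
    Ω-cong {δ} {δ′} δ≈δ′ = by-contradiction λ Ωδ⋠Ωδ′ → go (Ω δ′) refl (⋠⇒>∞ Ωδ⋠Ωδ′)
      where
      go : ∀ x → Ω δ′ ≡ x → ¬ x <∞ Ω δ
      go ∞       _  x<Ωδ = <∞⇒⋡ {∞} {Ω δ} x<Ωδ (wrap tt)
      go (fin t) eq x<Ωδ =
        let _ , _ , 0<η , near = lower-semicontinuous δ t x<Ωδ
        in <∞⇒⋡ (near δ′ λ i _ → ≈⇒∣-∣< (δ≈δ′ i) 0<η) (≼-reflexive eq)

    Ω-mono : ∀ {δ δ′} → δ ⊑ δ′ → Ω δ ≼ Ω δ′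
    Ω-mono {δ} {δ′} δ⊑δ′ =
      ≼-trans (wrap (mono δ (difference {δ = δ} {δ′} δ⊑δ′))) (Ω-cong (⊕-difference {δ = δ} {δ′} δ⊑δ′))

    ↾-mono : ∀ {n} {xs ys : Vector ℝ≥0 n} → xs ⊑ ys → W ↾ xs ≼ W ↾ ys
    ↾-mono xs⊑ys = Ω-mono (pad-mono xs⊑ys)

    ↾-subadd : ∀ {n} (xs ys : Vector ℝ≥0 n) → W ↾ (xs ⊕ ys) ≼ (W ↾ xs) +∞ (W ↾ ys)
    ↾-subadd xs ys = ≼-trans (Ω-mono pad-⊕) (wrap (subadd (pad xs) (pad ys)))
      where
      pad-⊕ : pad (xs ⊕ ys) ⊑ (pad xs ⊕ pad ys)
      pad-⊕ = pad-elim (xs ⊕ ys) (λ p x → val x ≤ val ((pad xs ⊕ pad ys) p))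
        (λ i → T.reflexive (R.sym (R.+-cong (R.reflexive (cong val (pad-toℕ xs i)))
                                            (R.reflexive (cong val (pad-toℕ ys i))))))
        (λ p _ → nonneg ((pad xs ⊕ pad ys) p))

    Ω-zero : Ω (λ _ → 0⁺) ≼ fin 0⁺
    Ω-zero = ≈∞⇒≼ (Ω λ _ → 0⁺) (fin 0⁺) at-zero

    -- Separate continuity and subadditivity give joint continuity at 0 in finitely many variables.
    -- Coordinate `n` is split off, induction controls the remaining ones, and each summand receives
    -- half of ε.
    Ω-small : ∀ n ε (0<ε : 0# < ε) → ∃[ η ] 0# < η ×
              (∀ δ → (∀ i → i ℕ.< n → val (δ i) ≤ η) → (∀ i → n ℕ.≤ i → val (δ i) ≤ 0#) →
               Ω δ ≼ fin (ε ,⁺ proj₁ 0<ε))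
    Ω-small zero ε 0<ε = 1# , 0<1 , λ δ _ zeros →
      ≼-trans (Ω-mono (λ i → zeros i z≤n))
        (≼-trans Ω-zero (wrap (proj₁ 0<ε)))
    Ω-small (suc n) ε 0<ε =
      let η₁ , 0<η₁ , small = Ω-small n (half 0<ε) (0<half 0<ε)
          η₂ , 0<η₂ , near  = separately-continuous-upper (λ _ → 0⁺) n 0⁺ h⁺ zero<h
          -- Halving `η₂` turns the weak bound on coordinate `n` into the strict one that `near`
          -- expects.
          η , 0<η , η≤η₁ , η≤h = min-pos 0<η₁ (0<half 0<η₂)
      in η , 0<η , λ δ δ≤η zeros →
        let at-n : Ω ((λ _ → 0⁺) [ n ≔ δ n ]) ≼ fin h⁺
            at-n = wrap (proj₁ (near (δ n) (≤-<-trans (∣x-y∣≤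
                     (T.trans (nonneg (δ n)) (x≤x+y (nonneg (δ n))))
                     (T.reflexive (R.sym (R.+-identityˡ _))))
                     (≤-<-trans (T.trans (δ≤η n ℕₚ.≤-refl) η≤h) (half< 0<η₂)))))
            below : Ω (δ [ n ≔ 0⁺ ]) ≼ fin h⁺
            below = small (δ [ n ≔ 0⁺ ])
              (λ i i<n → ≤-via (update-other δ n 0⁺ i (ℕₚ.<⇒≢ i<n)) (T.trans (δ≤η i (ℕₚ.m<n⇒m<1+n i<n)) η≤η₁))
              (zeros-above δ zeros)
        in ≼-trans (Ω-mono (split δ)) (≼-trans (wrap (subadd (δ [ n ≔ 0⁺ ]) ((λ _ → 0⁺) [ n ≔ δ n ])))
             (≼-trans (+∞-mono below at-n) (wrap (T.reflexive (half+half 0<ε)))))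
      where
      h⁺ = half 0<ε ,⁺ proj₁ (0<half 0<ε)

      ≤-via : ∀ {x y : ℝ≥0} {z} → x ≡ y → val y ≤ z → val x ≤ z
      ≤-via refl y≤z = y≤z

      zero<h : Ω ((λ _ → 0⁺) [ n ≔ 0⁺ ]) <∞ fin h⁺
      zero<h = ⋠⇒>∞ λ h≼ → <⇒≱ (0<half 0<ε) (unwrap (≼-trans h≼ (≼-trans (Ω-mono zeros) Ω-zero)))
        where
        zeros : ∀ i → val (((λ _ → 0⁺) [ n ≔ 0⁺ ]) i) ≤ 0#
        zeros i with i ℕₚ.≟ n
        ... | yes refl = ≤-via (update-same (λ _ → 0⁺) n 0⁺) T.refl
        ... | no i≢n   = ≤-via (update-other (λ _ → 0⁺) n 0⁺ i i≢n) T.refl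

      zeros-above : ∀ δ → (∀ i → suc n ℕ.≤ i → val (δ i) ≤ 0#) → ∀ i → n ℕ.≤ i → val ((δ [ n ≔ 0⁺ ]) i) ≤ 0#
      zeros-above δ zeros i n≤i with i ℕₚ.≟ n
      ... | yes refl = ≤-via (update-same δ n 0⁺) T.refl
      ... | no i≢n   = ≤-via (update-other δ n 0⁺ i i≢n) (zeros i (ℕₚ.≤∧≢⇒< n≤i (i≢n ∘ sym)))

      split : ∀ δ → δ ⊑ ((δ [ n ≔ 0⁺ ]) ⊕ ((λ _ → 0⁺) [ n ≔ δ n ]))
      split δ i with i ℕₚ.≟ n
      ... | yes refl = T.trans (≡⇒≤ (cong val (sym (update-same (λ _ → 0⁺) n (δ n)))))
                         (x≤y+x (nonneg ((δ [ n ≔ 0⁺ ]) n)))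
      ... | no i≢n   = T.trans (≡⇒≤ (cong val (sym (update-other δ n 0⁺ i i≢n))))
                         (x≤x+y (nonneg (((λ _ → 0⁺) [ n ≔ δ n ]) i)))

    ↾-small : ∀ n ε (0<ε : 0# < ε) → ∃[ η ] 0# < η ×
              (∀ (xs : Vector ℝ≥0 n) → (∀ i → val (xs i) ≤ η) → W ↾ xs ≼ fin (ε ,⁺ proj₁ 0<ε))
    ↾-small n ε 0<ε =
      let η , 0<η , small = Ω-small n ε 0<ε
      in η , 0<η , λ xs xs≤η → small (pad xs)
           (λ p _ → pad-elim xs (λ _ x → val x ≤ η) xs≤η (λ _ _ → proj₁ 0<η) p)
           (pad-elim xs (λ p x → n ℕ.≤ p → val x ≤ 0#)
             (λ i n≤i → contradiction (toℕ<n i) (ℕₚ.≤⇒≯ n≤i)) (λ _ _ _ → T.refl))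

    module _ (shift : ShiftIncreasing W) where

      -- Spreading `δ` along `ι`, with 0 off the image, gives a sequence to which the shift
      -- hypothesis applies literally, and which lies below `δ′` pointwise. Excluded middle decides
      -- membership in the image.
      Ω-shift : ∀ {ι δ δ′} → Increasing ι → (∀ p → val (δ p) ≤ val (δ′ (ι p))) → Ω δ ≼ Ω δ′
      Ω-shift {ι} {δ} {δ′} inc δ≤δ′ = ≼-trans
        (wrap (shift ι (Increasing⇒mono-< inc) δ spread (λ p → R.reflexive (cong val (on-image p em)))
          (λ k k∉ → off-image k k∉ em)))
        (Ω-mono (λ k → below k em))
        where
        spread-at : ∀ {k} → Dec (∃[ p ] k ≡ ι p) → ℝ≥0
        spread-at (yes (p , _)) = δ p
        spread-at (no _)        = 0⁺

        spread : Sequence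
        spread k = spread-at {k} em

        on-image : ∀ p (D : Dec (∃[ q ] ι p ≡ ι q)) → spread-at D ≡ δ p
        on-image p (yes (q , eq)) = cong δ (sym (Increasing⇒injective inc eq))
        on-image p (no ∉)         = contradiction (p , refl) ∉

        off-image : ∀ k → (∀ p → ¬ k ≡ ι p) → (D : Dec (∃[ q ] k ≡ ι q)) → val (spread-at D) ≈ 0#
        off-image k k∉ (yes (p , eq)) = contradiction eq (k∉ p)
        off-image k k∉ (no _)         = R.refl

        below : ∀ k (D : Dec (∃[ q ] k ≡ ι q)) → val (spread-at D) ≤ val (δ′ k)
        below k (yes (p , refl)) = δ≤δ′ p
        below k (no _)           = nonneg (δ′ k)

      -- This is a shift along the map that is the identity below `J` and continues with `ι`. The
      -- induction builds that map by prepending `J - 1`, `J - 2`, and so on.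
      Ω-embed : ∀ J {ι δ δ′} → Increasing ι → J ℕ.≤ ι 0 →
                (∀ p → p ℕ.< J → val (δ p) ≤ val (δ′ p)) →
                (∀ p → val (δ (J ℕ.+ p)) ≤ val (δ′ (ι p))) → Ω δ ≼ Ω δ′
      Ω-embed zero inc _ _ late = Ω-shift inc late
      Ω-embed (suc J) {ι} {δ} {δ′} inc J<ι₀ early late =
        Ω-embed J (◂-increasing J<ι₀ inc) ℕₚ.≤-refl (λ p p<J → early p (ℕₚ.m<n⇒m<1+n p<J)) late′
        where
        late′ : ∀ p → val (δ (J ℕ.+ p)) ≤ val (δ′ ((J ◂ ι) p))
        late′ zero    = subst (λ q → val (δ q) ≤ val (δ′ J)) (sym (ℕₚ.+-identityʳ J)) (early J ℕₚ.≤-refl)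
        late′ (suc p) = subst (λ q → val (δ q) ≤ val (δ′ (ι p))) (sym (ℕₚ.+-suc J p)) (late p)

  -- Suprema and infima in [0,∞]

  module _ {ℓ} {I : Set ℓ} (f : I → [0,∞]) where

    ≼-sup : ∀ i → f i ≼ sup f
    ≼-sup i = wrap (sup-upper f i)

    sup-≼ : ∀ {u} → (∀ i → f i ≼ u) → sup f ≼ u
    sup-≼ {u} f≼u = wrap (sup-least f u (λ i → unwrap (f≼u i)))

    inf-≼ : ∀ i → inf f ≼ f i
    inf-≼ i = wrap (inf-lower f i)

    ≼-inf : ∀ {l} → (∀ i → l ≼ f i) → l ≼ inf f
    ≼-inf {l} l≼f = wrap (inf-greatest f l (λ i → unwrap (l≼f i)))

    sup-⋠ : ∀ {u} → ¬ sup f ≼ u → ∃[ i ] ¬ f i ≼ u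
    sup-⋠ sup⋠u = by-contradiction λ none →
      sup⋠u (sup-≼ λ i → by-contradiction λ fi⋠u → none (i , fi⋠u))

    ⋠-inf : ∀ {l} → ¬ l ≼ inf f → ∃[ i ] ¬ l ≼ f i
    ⋠-inf l⋠inf = by-contradiction λ none →
      l⋠inf (≼-inf λ i → by-contradiction λ l⋠fi → none (i , l⋠fi))

  module _ {X : Set} where

    ∷ʳ-inject₁ : ∀ {n} (a : Vector X n) c i → (a ∷ʳ c) (inject₁ i) ≡ a i
    ∷ʳ-inject₁ a c zero    = refl
    ∷ʳ-inject₁ a c (suc i) = ∷ʳ-inject₁ (tail a) c i

    ∷ʳ-fromℕ : ∀ {n} (a : Vector X n) c → (a ∷ʳ c) (fromℕ n) ≡ c
    ∷ʳ-fromℕ {n} a c = insertAt-lookup a (fromℕ n) c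

  -- Padding continues a tuple with zeros, so a last entry that is 0 cannot be told from the
  -- padding.
  pad-snoc : ∀ {n} {xs : Vector ℝ≥0 (suc n)} {ys : Vector ℝ≥0 n} →
             (∀ i → val (xs (inject₁ i)) ≤ val (ys i)) → val (xs (fromℕ n)) ≤ 0# → pad xs ⊑ pad ys
  pad-snoc {zero}           init≤ last≤ zero    = last≤
  pad-snoc {zero}           init≤ last≤ (suc p) = T.refl
  pad-snoc {suc n}          init≤ last≤ zero    = init≤ zero
  pad-snoc {suc n} {xs} {ys} init≤ last≤ (suc p) = pad-snoc {xs = tail xs} {tail ys} (init≤ ∘ suc) last≤ p

  -- Terms, formulas and their moduli

  module _ {L : Signature} where
    open Signature L

    Δᴾ-mono : ∀ P {δ δ′} → δ ⊑ δ′ → val (Δᴾ L P δ) ≤ val (Δᴾ L P δ′)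
    Δᴾ-mono dist    δ⊑δ′ = +-mono-≤ (δ⊑δ′ zero) (δ⊑δ′ (suc zero))
    Δᴾ-mono (rel R) {δ} {δ′} δ⊑δ′ = Modulus-mono (rel-mod R) {δ} {δ′} δ⊑δ′

    Δᴾ-zero : ∀ P {δ} → (∀ i → val (δ i) ≤ 0#) → val (Δᴾ L P δ) ≤ 0#
    Δᴾ-zero dist    δ≤0 = T.trans (+-mono-≤ (δ≤0 zero) (δ≤0 (suc zero))) (T.reflexive (R.+-identityˡ 0#))
    Δᴾ-zero (rel R) {δ} δ≤0 =
      T.trans (Modulus-mono (rel-mod R) {δ} {λ _ → 0⁺} δ≤0) (T.reflexive (Modulus.at-zero (rel-mod R)))

    renameᵀ : ∀ {k n} → (Fin k → Fin n) → Term L k → Term L n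
    renameᵀ σ (var i)   = var (σ i)
    renameᵀ σ (app F τ) = app F (λ i → renameᵀ σ (τ i))

    renameᴬ : ∀ {k n} → (Fin k → Fin n) → Atomic L k → Atomic L n
    renameᴬ σ (atom P τ) = atom P (λ i → renameᵀ σ (τ i))

    Δᵀ-rename : ∀ {k n} (σ : Fin k → Fin n) t δ → val (Δᵀ (renameᵀ σ t) δ) ≈ val (Δᵀ t (δ ∘ σ))
    Δᵀ-rename σ (var i)   δ = R.refl
    Δᵀ-rename σ (app F τ) δ = Modulus-cong (fun-mod F) λ i → Δᵀ-rename σ (τ i) δ

    Δᴬ-rename : ∀ {k n} (σ : Fin k → Fin n) φ δ → val (Δᴬ (renameᴬ σ φ) δ) ≤ val (Δᴬ φ (δ ∘ σ))
    Δᴬ-rename σ (atom P τ) δ = Δᴾ-mono P λ i → T.reflexive (Δᵀ-rename σ (τ i) δ)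

    module StructureProperties (A : Structure L) where
      open Structure A
      module M = IsGeneralMetric isMetric

      ≈⇒d≤0 : ∀ {x y} → x ≈ₛ y → d x y ≤ 0#
      ≈⇒d≤0 x≈y = T.reflexive (M.≈⇒0 x≈y)

      d≤0⇒≈ : ∀ {x y} → d x y ≤ 0# → x ≈ₛ y
      d≤0⇒≈ d≤0 = M.0⇒≈ (T.antisym d≤0 M.nonNegative)

      d-refl≤ : ∀ {x y ε} → x ≡ y → 0# ≤ ε → d x y ≤ ε
      d-refl≤ refl 0≤ε = T.trans (≈⇒d≤0 M.EqC.refl) 0≤ε

      d-sym≤ : ∀ {x y c} → d x y ≤ c → d y x ≤ c
      d-sym≤ {x} {y} = T.≤-respˡ-≈ (M.sym x y)

      d-triangle : ∀ {x y z c c′} → d x y ≤ c → d y z ≤ c′ → d x z ≤ c + c′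
      d-triangle {x} {y} {z} p q = T.trans (M.triangle x y z) (+-mono-≤ p q)

      -- This makes the distance predicate respect its modulus, the sum of the two arguments. Each
      -- direction is the triangle inequality used twice.
      d-lipschitz : ∀ x y x′ y′ → ∣ d x y - d x′ y′ ∣ ≤ d x x′ + d y y′
      d-lipschitz x y x′ y′ = ∣x-y∣≤
        (rearrange (d-triangle (T.refl {d x x′}) (d-triangle (T.refl {d x′ y′}) (d-sym≤ (T.refl {d y y′})))))
        (rearrange (d-triangle (d-sym≤ (T.refl {d x x′})) (d-triangle (T.refl {d x y}) (T.refl {d y y′}))))
        where
        rearrange : ∀ {u a b c} → u ≤ a + (b + c) → u ≤ b + (a + c)
        rearrange = T.≤-respʳ-≈ (+ₛ.x∙yz≈y∙xz _ _ _)

      fun-cong : ∀ F {x y} → (∀ i → x i ≈ₛ y i) → fun F x ≈ₛ fun F y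
      fun-cong F {x} {y} x≈y = d≤0⇒≈ (T.trans (fun-respects F x y)
        (T.trans (Modulus-mono (fun-mod F) {λ i → d⁺ (x i) (y i)} {λ _ → 0⁺} λ i → ≈⇒d≤0 (x≈y i))
          (T.reflexive (Modulus.at-zero (fun-mod F)))))

      pred-respects : ∀ P x y → ∣ proj₁ (pred P x) - proj₁ (pred P y) ∣ ≤ val (Δᴾ L P (λ i → d⁺ (x i) (y i)))
      pred-respects dist    x y = d-lipschitz (x zero) (x (suc zero)) (y zero) (y (suc zero))
      pred-respects (rel R) x y = relation-respects R x y

      pred-cong : ∀ P {x y} → (∀ i → x i ≈ₛ y i) → proj₁ (pred P x) ≈ proj₁ (pred P y)
      pred-cong P {x} {y} x≈y = ∣-∣≤0⇒≈
        (T.trans (pred-respects P x y) (Δᴾ-zero P {λ i → d⁺ (x i) (y i)} λ i → ≈⇒d≤0 (x≈y i)))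

      evalᵀ-respects : ∀ {n} (t : Term L n) x y →
                       d (evalᵀ A t x) (evalᵀ A t y) ≤ val (Δᵀ t (λ i → d⁺ (x i) (y i)))
      evalᵀ-respects (var i)   x y = T.refl
      evalᵀ-respects (app F τ) x y = T.trans (fun-respects F _ _)
        (Modulus-mono (fun-mod F) {λ i → d⁺ (evalᵀ A (τ i) x) (evalᵀ A (τ i) y)}
          {λ i → Δᵀ (τ i) (λ j → d⁺ (x j) (y j))} λ i → evalᵀ-respects (τ i) x y)

      evalᴬ-respects : ∀ {n} (φ : Atomic L n) x y →
                       ∣ proj₁ (evalᴬ A φ x) - proj₁ (evalᴬ A φ y) ∣ ≤ val (Δᴬ φ (λ i → d⁺ (x i) (y i)))
      evalᴬ-respects (atom P τ) x y =
        T.trans (pred-respects P _ _) (Δᴾ-mono P λ i → evalᵀ-respects (τ i) x y)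

      evalᵀ-rename : ∀ {k n} (σ : Fin k → Fin n) t {a a′} → (∀ i → a (σ i) ≡ a′ i) →
                     evalᵀ A (renameᵀ σ t) a ≈ₛ evalᵀ A t a′
      evalᵀ-rename σ (var i)   eq = M.EqC.reflexive (eq i)
      evalᵀ-rename σ (app F τ) eq = fun-cong F λ i → evalᵀ-rename σ (τ i) eq

      evalᴬ-rename : ∀ {k n} (σ : Fin k → Fin n) φ {a a′} → (∀ i → a (σ i) ≡ a′ i) →
                     proj₁ (evalᴬ A (renameᴬ σ φ) a) ≈ proj₁ (evalᴬ A φ a′)
      evalᴬ-rename σ (atom P τ) eq = pred-cong P λ i → evalᵀ-rename σ (τ i) eq

    -- The upper bound given by an isomorphism

    module _ {A B : Structure L} (iso : Isomorphism A B) where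
      private
        module A = Structure A
        module B = Structure B
        module Bₚ = StructureProperties B
      open Isomorphism iso

      evalᵀ-preserved : ∀ {n} (t : Term L n) a → to (evalᵀ A t a) B.≈ₛ evalᵀ B t (to ∘ a)
      evalᵀ-preserved (var i)   a = Bₚ.M.EqC.refl
      evalᵀ-preserved (app F τ) a =
        Bₚ.M.EqC.trans (fun-pres F _) (Bₚ.fun-cong F λ i → evalᵀ-preserved (τ i) a)

      evalᴬ-preserved : ∀ {n} (φ : Atomic L n) a → proj₁ (evalᴬ A φ a) ≈ proj₁ (evalᴬ B φ (to ∘ a))
      evalᴬ-preserved (atom P τ) a =
        R.trans (pred-pres P _) (Bₚ.pred-cong P λ i → evalᵀ-preserved (τ i) a)

      module _ (W : WeakModulus) where
        open BackAndForth W A B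
        open WeakModulusProperties W

        -- A move answered by the isomorphism is free: the new coordinate has distance 0, so d^Ω
        -- does not grow.
        dist^-∷ʳ : ∀ {n} (a : Vector A.Carrier n) (b : Vector B.Carrier n) {c d} → to c B.≈ₛ d →
                   dist^ W B (to ∘ (a ∷ʳ c)) (b ∷ʳ d) ≼ dist^ W B (to ∘ a) b
        dist^-∷ʳ {n} a b {c} {d} fc≈d = Ω-mono (pad-snoc
          (λ i → ≡⇒≤ (cong₂ (λ x y → B.d (to x) y) (∷ʳ-inject₁ a c i) (∷ʳ-inject₁ b d i)))
          (T.≤-respˡ-≈ (R.reflexive (sym (cong₂ (λ x y → B.d (to x) y) (∷ʳ-fromℕ a c) (∷ʳ-fromℕ b d))))
            (Bₚ.≈⇒d≤0 fc≈d)))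

        -- The atomic values at `a` equal those at `to ∘ a`, which differ from those at `b` by at
        -- most the atomic moduli. Hence the two families of values form a pair occurring in the
        -- supremum `Δᶠ`, and `Δᴮ φ` is below Ω.
        r-zero≼dist^ : ∀ {n} a (b : Vector B.Carrier n) → r-zero a b ≼ dist^ W B (to ∘ a) b
        r-zero≼dist^ a b = sup-≼ _ λ (φ , φ≤Ω) →
          ≼-trans (≼-sup _ ((λ i → evalᴬ A (Basic.atoms φ i) a) , (λ i → evalᴬ B (Basic.atoms φ i) b) ,
                    λ i → T.trans (∣-∣-trans (≈⇒∣-∣≤ (evalᴬ-preserved (Basic.atoms φ i) a) T.refl)
                                              (Bₚ.evalᴬ-respects (Basic.atoms φ i) (to ∘ a) b))
                            (T.reflexive (R.+-identityˡ _))))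
                  (wrap (φ≤Ω (λ i → B.d⁺ (to (a i)) (b i))))

        mutual
          -- The bound does not depend on `α`, and by `dist^-∷ʳ` a round does not increase it, so it
          -- passes through successors and suprema alike.
          r≼dist^ : ∀ α {n} a (b : Vector B.Carrier n) → r α a b ≼ dist^ W B (to ∘ a) b
          r≼dist^ zero      a b = r-zero≼dist^ a b
          r≼dist^ (suc α)   a b = sup-≼ _ λ (c , d) →
            let c′ , to-c′ = IsBijection.surjective isBijection d
            in ≼-trans (inf-≼ (λ (c′ , d′) → max∞ (r α (a ∷ʳ c) (b ∷ʳ d′)) (r α (a ∷ʳ c′) (b ∷ʳ d))) (c′ , to c))
                 (max∞-lub
                 (≼-trans (r≼dist^ α (a ∷ʳ c) (b ∷ʳ to c)) (dist^-∷ʳ a b Bₚ.M.EqC.refl))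
                 (≼-trans (r≼dist^ α (a ∷ʳ c′) (b ∷ʳ d)) (dist^-∷ʳ a b (to-c′ (IsGeneralMetric.EqC.refl A.isMetric)))))
          r≼dist^ (lim I f) a b = sup-≼ _ λ (i , p) → r-below≼dist^ (f i) p a b

          r-below≼dist^ : ∀ α p {n} a (b : Vector B.Carrier n) → r-below α p a b ≼ dist^ W B (to ∘ a) b
          r-below≼dist^ (suc α)   nothing  a b = r≼dist^ α a b
          r-below≼dist^ (suc α)   (just p) a b = r-below≼dist^ α p a b
          r-below≼dist^ (lim I f) (i , p)  a b = r-below≼dist^ (f i) p a b

        r∞≼dist^ : ∀ {n} a (b : Vector B.Carrier n) → r∞ a b ≼ dist^ W B (to ∘ a) b
        r∞≼dist^ a b = sup-≼ _ λ (α , _) → r≼dist^ α a b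

  -- Attainment of r∞

  ≤ₒ-lim : ∀ α {I f} i → α ≤ₒ f i → α ≤ₒ lim I f
  ≤ₒ-lim zero      i _  = tt
  ≤ₒ-lim (suc α)   i α< = i , α<
  ≤ₒ-lim (lim J g) i g≤ = λ j → ≤ₒ-lim (g j) i (g≤ j)

  ≤ₒ-refl : ∀ α → α ≤ₒ α
  ≤ₒ-refl zero      = tt
  ≤ₒ-refl (suc α)   = ≤ₒ-refl α
  ≤ₒ-refl (lim I f) = λ i → ≤ₒ-lim (f i) i (≤ₒ-refl (f i))

  sucs : ℕ → Ord → Ord
  sucs zero    α = α
  sucs (suc n) α = suc (sucs n α)

  sucs-isOrdinal : ∀ n {α} → IsOrdinal α → IsOrdinal (sucs n α)
  sucs-isOrdinal zero    ord = ord
  sucs-isOrdinal (suc n) ord = sucs-isOrdinal n ord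

  module StableRank {L : Signature} (W : WeakModulus) (A B : Structure L) where
    open BackAndForth W A B
    private
      module A = Structure A
      module B = Structure B

      -- A query asks whether `r∞ a b` exceeds `t`. Queries live in `Set`, where `lim` takes its
      -- index types, although the ordinals that answer them live in `Set₁`.
      Query : Set
      Query = Σ[ n ∈ ℕ ] Vector A.Carrier n × Vector B.Carrier n × ℝ≥0

      Exceeded : Query → Set₁
      Exceeded (n , a , b , t) = Σ[ α ∈ Ord ] IsOrdinal α × ¬ r α a b ≼ fin t

      witness : ∀ q → Dec (Exceeded q) → Σ[ α ∈ Ord ] IsOrdinal α
      witness q (yes (α , ord , _)) = α , ord
      witness q (no _)              = zero , tt

      witness-exceeds : ∀ n a b t → (D : Dec (Exceeded (n , a , b , t))) → ¬ r∞ a b ≼ fin t →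
                        ¬ r (proj₁ (witness (n , a , b , t) D)) a b ≼ fin t
      witness-exceeds n a b t (yes (_ , _ , r⋠t)) _ = r⋠t
      witness-exceeds n a b t (no none) r∞⋠t =
        let (α , ord) , r⋠t = sup-⋠ _ r∞⋠t in contradiction (α , ord , r⋠t) none

      rank : Maybe Query → Σ[ α ∈ Ord ] IsOrdinal α
      -- The extra point provides the member that `IsOrdinal` requires of the family in a limit.
      rank nothing  = zero , tt
      rank (just q) = witness q em

    -- The product with ℕ makes the family cofinal in itself, as a limit requires.
    stable-rank : Ord
    stable-rank = lim (Maybe Query × ℕ) λ (q , n) → sucs n (proj₁ (rank q))

    stable-rank-isOrdinal : IsOrdinal stable-rank
    stable-rank-isOrdinal = (nothing , 0) , (λ (q , n) → sucs-isOrdinal n (proj₂ (rank q))) ,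
      λ (q , n) → (q , suc n) , ≤ₒ-refl (sucs n (proj₁ (rank q)))

    r∞≼r-stable-rank : ∀ {n} a (b : Vector B.Carrier n) → r∞ a b ≼ r stable-rank a b
    r∞≼r-stable-rank {n} a b = go (r stable-rank a b) refl
      where
      go : ∀ x → r stable-rank a b ≡ x → r∞ a b ≼ x
      go ∞       _  = wrap tt
      -- Here `t` is the value at `stable-rank` itself. `Below` lists strictly smaller ordinals, so
      -- the index takes the first successor of the witness for this query, below which `nothing`
      -- denotes the witness.
      go (fin t) eq = by-contradiction λ r∞⋠t → witness-exceeds n a b t em r∞⋠t
        (≼-trans (≼-sup (λ (i , p) → r-below _ p a b) ((just (n , a , b , t) , 1) , nothing)) (≼-reflexive eq))

    r-zero≼r∞ : ∀ {n} a (b : Vector B.Carrier n) → r-zero a b ≼ r∞ a b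
    r-zero≼r∞ a b = ≼-sup (λ (α , _) → r α a b) (zero , tt)

    private
      -- `¬ x ≼ r∞ a b` stands for `r∞ a b < x`. As `r∞` dominates the level after `stable-rank`,
      -- the infimum there is below `x` too, so some pair of replies stays below `x` at
      -- `stable-rank`, and `r∞` is no larger.
      ⋠-step : ∀ {x n} a (b : Vector B.Carrier n) → ¬ x ≼ r∞ a b → ∀ c d → ∃[ (c′ , d′) ]
               ¬ x ≼ max∞ (r stable-rank (a ∷ʳ c) (b ∷ʳ d′)) (r stable-rank (a ∷ʳ c′) (b ∷ʳ d))
      ⋠-step a b x⋠ c d = ⋠-inf _ λ x≼inf → x⋠ (≼-trans x≼inf (≼-trans (≼-sup _ (c , d))
        (≼-sup (λ (α , _) → r α a b) (suc stable-rank , stable-rank-isOrdinal))))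

    forth : ∀ {x n} a (b : Vector B.Carrier n) → ¬ x ≼ r∞ a b → ∀ c → ∃[ d ] ¬ x ≼ r∞ (a ∷ʳ c) (b ∷ʳ d)
    forth a b x⋠ c =
      -- A round poses a challenge on each side. An arbitrary point of `B` completes the pair, and
      -- only the reply to `c` is kept.
      let (_ , d) , x⋠max = ⋠-step a b x⋠ c B.nonempty
      in d , λ x≼ → x⋠max (≼-trans (≼-trans x≼ (r∞≼r-stable-rank (a ∷ʳ c) (b ∷ʳ d))) (max∞-upperˡ _ _))

    back : ∀ {x n} a (b : Vector B.Carrier n) → ¬ x ≼ r∞ a b → ∀ d → ∃[ c ] ¬ x ≼ r∞ (a ∷ʳ c) (b ∷ʳ d)
    back a b x⋠ d =
      let (c , _) , x⋠max = ⋠-step a b x⋠ A.nonempty d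
      in c , λ x≼ → x⋠max (≼-trans (≼-trans x≼ (r∞≼r-stable-rank (a ∷ʳ c) (b ∷ʳ d))) (max∞-upperʳ _ _))

  -- Back-and-forth sequences

  -- The first component runs through 0; 1, 0; 2, 1, 0; …
  countdown : ℕ → ℕ × ℕ
  countdown zero    = 0 , 0
  countdown (suc n) = next (countdown n)
    where
    next : ℕ × ℕ → ℕ × ℕ
    next (zero  , top) = suc top , suc top
    next (suc x , top) = x , top

  countdown-descends : ∀ j {n x top} → countdown n ≡ (j ℕ.+ x , top) → countdown (j ℕ.+ n) ≡ (x , top)
  countdown-descends zero    eq = eq
  countdown-descends (suc j) {n} {x} {top} eq
    rewrite countdown-descends j {n} {suc x} (trans eq (cong (_, top) (sym (ℕₚ.+-suc j x)))) = refl

  countdown-tops : ∀ top → ∃[ n ] top ℕ.≤ n × countdown n ≡ (top , top)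
  countdown-tops zero      = 0 , z≤n , refl
  countdown-tops (suc top) =
    let n , top≤n , eq = countdown-tops top
    in suc (top ℕ.+ n) , s≤s (ℕₚ.m≤m+n top n) , step n eq
    where
    step : ∀ n → countdown n ≡ (top , top) → countdown (suc (top ℕ.+ n)) ≡ (suc top , suc top)
    step n eq rewrite countdown-descends top {n} {0} (trans eq (cong (_, top) (sym (ℕₚ.+-identityʳ top)))) = refl

  -- The descent from `N + x` reaches `x` after `N` steps, hence at an index of at least `N`.
  countdown-recurrent : ∀ x N → ∃[ n ] N ℕ.≤ n × proj₁ (countdown n) ≡ x
  countdown-recurrent x N =
    let n , N+x≤n , eq = countdown-tops (N ℕ.+ x)
    in N ℕ.+ n , ℕₚ.m≤m+n N n , cong proj₁ (countdown-descends N eq)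

  module _ {X Y : Set} where

    interleave : (ℕ → X) → (ℕ → Y) → ℕ → X ⊎ Y
    interleave s t zero          = inj₁ (s 0)
    interleave s t (suc zero)    = inj₂ (t 0)
    interleave s t (suc (suc n)) = interleave (s ∘ suc) (t ∘ suc) n

    interleave-inj₁ : ∀ s t n → ∃[ m ] interleave s t m ≡ inj₁ (s n)
    interleave-inj₁ s t zero    = 0 , refl
    interleave-inj₁ s t (suc n) =
      let m , eq = interleave-inj₁ (s ∘ suc) (t ∘ suc) n in suc (suc m) , eq

    interleave-inj₂ : ∀ s t n → ∃[ m ] interleave s t m ≡ inj₂ (t n)
    interleave-inj₂ s t zero    = 1 , refl
    interleave-inj₂ s t (suc n) =
      let m , eq = interleave-inj₂ (s ∘ suc) (t ∘ suc) n in suc (suc m) , eq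

  -- Each `Good q` holds at arbitrarily large indices, so the values are chosen one after another,
  -- each beyond the last. After the `k` chosen values `ι` counts on upwards, since shifts need an
  -- increasing map on all of ℕ.
  choose-increasing : ∀ k (Good : Fin k → ℕ → Set) → (∀ q N → ∃[ i ] N ℕ.≤ i × Good q i) →
                      ∀ N → ∃[ ι ] Increasing ι × N ℕ.≤ ι 0 × (∀ q → Good q (ι (toℕ q)))
  choose-increasing zero    Good often N =
    (N ℕ.+_) , (λ p → ℕₚ.+-monoʳ-< N (ℕₚ.n<1+n p)) , ℕₚ.m≤m+n N 0 , λ ()
  choose-increasing (suc k) Good often N =
    let i , N≤i , good          = often zero N
        ι , inc , i<ι₀ , good′  = choose-increasing k (Good ∘ suc) (often ∘ suc) (suc i)
    in i ◂ ι , ◂-increasing i<ι₀ inc , N≤i , λ { zero → good ; (suc q) → good′ q }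

  pad-reindex : ∀ {k n} (σ : Fin k → Fin n) (ρ : ℕ → ℕ) → (∀ q → toℕ (σ q) ≡ ρ (toℕ q)) →
                ∀ δ p → val (pad (δ ∘ σ) p) ≤ val (pad δ (ρ p))
  pad-reindex σ ρ eq δ = pad-elim (δ ∘ σ) (λ p x → val x ≤ val (pad δ (ρ p)))
    (λ q → ≡⇒≤ (cong val (trans (sym (pad-toℕ δ (σ q))) (cong (pad δ) (eq q)))))
    (λ p _ → nonneg (pad δ (ρ p)))

  -- Atomic formulas in late variables

  ·∞-mono : ∀ M {x y} → x ≼ y → (M ·∞ x) ≼ (M ·∞ y)
  ·∞-mono M {y = ∞}             _          = wrap tt
  ·∞-mono M {fin _} {fin _} (wrap x≤y) = wrap (*-monoʳ-≤ (nonneg M) x≤y)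

  module UniversalProperties {L : Signature} {W : WeakModulus} (U : IsUniversal L W) where
    open IsUniversal U
    open WeakModulusProperties W

    -- The universal bound on `Δᴬ φ` involves only finitely many coordinates, in which Ω is
    -- continuous at 0.
    Δᴬ-small : ∀ {k} (φ : Atomic L k) ε → 0# < ε → ∃[ η ] 0# < η ×
               (∀ δ → (∀ i → val (δ i) ≤ η) → val (Δᴬ φ δ) ≤ ε)
    Δᴬ-small {k} φ ε 0<ε =
      let j , Δφ≤        = universal₁ φ
          η , 0<η , small = ↾-small (j ℕ.+ k) ε 0<ε
      in η , 0<η , λ δ δ≤η → unwrap (≼-trans (wrap (Δφ≤ δ))
           (small (replicate j 0⁺ ++ δ) (++⁺ (λ x → val x ≤ η) {xs = replicate j 0⁺} (λ _ → proj₁ 0<η) δ≤η)))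

    -- `universal₁` dominates `Δᴬ φ` by Ω behind `j` zeros, and `universal₂` absorbs the factor `M`
    -- at the price of `j′` more zeros. `Ω-embed` then moves the variables to any increasing
    -- positions from `j′ + j` onwards.
    Δᴬ-late : ∀ {k} (φ : Atomic L k) (M : ℝ≥0) → 0# < val M → ∃[ J ]
              (∀ {n} (σ : Fin k → Fin n) ι → Increasing ι → J ℕ.≤ ι 0 → (∀ q → toℕ (σ q) ≡ ι (toℕ q)) →
               ∀ δ → fin (M *⁺ Δᴬ φ (δ ∘ σ)) ≼ W ↾ δ)
    Δᴬ-late {k} φ M 0<M =
      let j , Δφ≤ = universal₁ φ
          j′ , M≤ = universal₂ (j ℕ.+ k) M 0<M
      in j′ ℕ.+ j , λ σ ι inc J≤ι₀ σ≡ι δ →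
        let zeros = replicate j 0⁺ ++ (δ ∘ σ)
        in ≼-trans (·∞-mono M (wrap (Δφ≤ (δ ∘ σ)))) (≼-trans (wrap (M≤ zeros))
             (Ω-embed universal₄ (j′ ℕ.+ j) inc J≤ι₀
               (λ p p<J → T.trans (≡⇒≤ (cong val (leading j′ j (δ ∘ σ) p p<J))) (nonneg (pad δ p)))
               (λ p → T.trans (≡⇒≤ (cong val (trailing j′ j (δ ∘ σ) p)))
                        (pad-reindex σ ι σ≡ι δ p))))
      where
      leading : ∀ {k} j′ j (δ : Vector ℝ≥0 k) p → p ℕ.< j′ ℕ.+ j →
                pad (replicate j′ 0⁺ ++ (replicate j 0⁺ ++ δ)) p ≡ 0⁺
      leading zero     j δ p p<j = trans (pad-++ˡ (replicate j 0⁺) δ p<j) (pad-replicate j p)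
      leading (suc j′) j δ zero    _         = refl
      leading (suc j′) j δ (suc p) (s≤s p<J) =
        trans (pad-cong (++-tail (replicate (suc j′) 0⁺) (replicate j 0⁺ ++ δ)) p) (leading j′ j δ p p<J)

      trailing : ∀ {k} j′ j (δ : Vector ℝ≥0 k) p →
                 pad (replicate j′ 0⁺ ++ (replicate j 0⁺ ++ δ)) (j′ ℕ.+ j ℕ.+ p) ≡ pad δ p
      trailing j′ j δ p = trans (cong (pad (replicate j′ 0⁺ ++ (replicate j 0⁺ ++ δ))) (ℕₚ.+-assoc j′ j p))
        (trans (pad-++ʳ (replicate j′ 0⁺) (replicate j 0⁺ ++ δ) (j ℕ.+ p)) (pad-++ʳ (replicate j 0⁺) δ p))

  module _ {L : Signature} {n : ℕ} (M : ℝ≥0) (0<M : 0# < val M) (φ : Atomic L n) where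

    scaled : Basic L n
    scaled = record
      { size       = 1
      ; atoms      = λ _ → φ
      ; f          = λ x → val M * proj₁ (x zero)
      ; continuous = λ x ε 0<ε →
          let η , 0<η , Mη≈h = divide 0<M (0<half 0<ε)
          in η , 0<η , λ y near → ≤-<-trans (*-∣-∣ (nonneg M) (proj₁ (near zero)))
               (≤-<-trans (T.reflexive Mη≈h) (half< 0<ε))
      }

    Δᴮ-scaled : ∀ δ → Δᴮ scaled δ ≼ fin (M *⁺ Δᴬ φ δ)
    Δᴮ-scaled δ = sup-≼ _ λ (x , y , near) → wrap (*-∣-∣ (nonneg M) (near zero))

  module BackAndForthSequences {L : Signature} {W : WeakModulus} (U : IsUniversal L W) (A B : Structure L)
    (sepA : Separable A) (sepB : Separable B)
    (t : ℝ≥0) {k : ℕ} (v : Vector (Structure.Carrier A) k) (w : Vector (Structure.Carrier B) k)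
    (t⋠ : ¬ fin t ≼ BackAndForth.r∞ W A B v w) where

    open BackAndForth W A B
    open StableRank W A B
    private
      module A = Structure A
      module B = Structure B
      module Aₚ = StructureProperties A
      module Bₚ = StructureProperties B

    schedule : ℕ → A.Carrier ⊎ B.Carrier
    schedule n = interleave (proj₁ sepA) (proj₁ sepB) (proj₁ (countdown n))

    Realises : A.Carrier ⊎ B.Carrier → A.Carrier → B.Carrier → Set
    Realises (inj₁ x) c d = c ≡ x
    Realises (inj₂ y) c d = d ≡ y

    -- Writing the length as `n + k` makes the length after one append reduce to that of stage
    -- `suc n`. The invariant `close` says that `r∞ < t`.
    record Stage (n : ℕ) : Set where
      field
        left  : Vector A.Carrier (n ℕ.+ k)
        right : Vector B.Carrier (n ℕ.+ k)
        close : ¬ fin t ≼ r∞ left right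
    open Stage

    extension : ∀ {n} (S : Stage n) z → Σ[ c ∈ A.Carrier ] Σ[ d ∈ B.Carrier ]
                (¬ fin t ≼ r∞ (left S ∷ʳ c) (right S ∷ʳ d)) × Realises z c d
    extension S (inj₁ x) = let d , close′ = forth (left S) (right S) (close S) x in x , d , close′ , refl
    extension S (inj₂ y) = let c , close′ = back (left S) (right S) (close S) y in c , y , close′ , refl

    stage : ∀ n → Stage n
    stage zero    = record { left = v ; right = w ; close = t⋠ }
    stage (suc n) = let c , d , close′ , _ = extension (stage n) (schedule n) in
      record { left = left (stage n) ∷ʳ c ; right = right (stage n) ∷ʳ d ; close = close′ }

    c : ℕ → A.Carrier
    c n = proj₁ (extension (stage n) (schedule n))

    d : ℕ → B.Carrier
    d n = proj₁ (proj₂ (extension (stage n) (schedule n)))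

    realised : ∀ n {z} → schedule n ≡ z → Realises z (c n) (d n)
    realised n refl = proj₂ (proj₂ (proj₂ (extension (stage n) (schedule n))))

    -- Points are only appended, so the index `i` of a pair never changes, whereas the type
    -- `Fin (m + k)` of its position depends on the stage. The record carries the index along.
    record Entry (m i : ℕ) (x : A.Carrier) (y : B.Carrier) : Set where
      field
        position : Fin (m ℕ.+ k)
        index    : toℕ position ≡ i
        at-left  : left (stage m) position ≡ x
        at-right : right (stage m) position ≡ y
    open Entry public

    entry-suc : ∀ {m i x y} → Entry m i x y → Entry (suc m) i x y
    entry-suc {m} e = record
      { position = inject₁ (position e)
      ; index    = trans (toℕ-inject₁ (position e)) (index e)
      ; at-left  = trans (∷ʳ-inject₁ (left (stage m)) (c m) (position e)) (at-left e)
      ; at-right = trans (∷ʳ-inject₁ (right (stage m)) (d m) (position e)) (at-right e)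
      }

    entry-mono : ∀ {m m′ i x y} → m ℕ.≤ m′ → Entry m i x y → Entry m′ i x y
    entry-mono m≤m′ e = go (ℕₚ.≤⇒≤′ m≤m′)
      where
      go : ∀ {m′} → _ ℕ.≤′ m′ → Entry m′ _ _ _
      go (ℕ.≤′-reflexive refl) = e
      go (ℕ.≤′-step m≤′m′)     = entry-suc (go m≤′m′)

    entry-initial : ∀ m q → Entry m (toℕ q) (v q) (w q)
    entry-initial m q = entry-mono z≤n
      (record { position = q ; index = refl ; at-left = refl ; at-right = refl })

    entry-new : ∀ {n m} → n ℕ.< m → Entry m (n ℕ.+ k) (c n) (d n)
    entry-new {n} n<m = entry-mono n<m (record
      { position = fromℕ (n ℕ.+ k)
      ; index    = toℕ-fromℕ (n ℕ.+ k)
      ; at-left  = ∷ʳ-fromℕ (left (stage n)) (c n)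
      ; at-right = ∷ʳ-fromℕ (right (stage n)) (d n)
      })

    -- As `ι q < ι l` for `q < l`, stage `ι l` already contains the first `l` chosen pairs.
    entry-ι : ∀ {ι l} → Increasing ι → (q : Fin l) → Entry (ι l) (ι (toℕ q) ℕ.+ k) (c (ι (toℕ q))) (d (ι (toℕ q)))
    entry-ι inc q = entry-new (Increasing⇒mono-< inc _ _ (toℕ<n q))

    -- The difference is one term of the supremum `r-zero`, which is at most `r∞` and hence at most
    -- `t`.
    basic-close : ∀ m (φ : Basic L (m ℕ.+ k)) → (∀ δ → Δᴮ φ δ ≼ W ↾ δ) →
                  ∣ evalᴮ φ A (left (stage m)) - evalᴮ φ B (right (stage m)) ∣ ≤ val t
    basic-close m φ φ≼Ω = unwrap (≼-trans (≼-sup _ (φ , λ δ → unwrap (φ≼Ω δ)))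
      (≼-trans (r-zero≼r∞ (left (stage m)) (right (stage m))) (⋠⇒≽ (close (stage m)))))

    c-dense : ∀ x ε N → 0# < ε → ∃[ i ] N ℕ.≤ i × A.d (c i) x ≤ ε
    c-dense x ε N 0<ε =
      let n , near     = proj₂ sepA x ε 0<ε
          m , eq       = interleave-inj₁ (proj₁ sepA) (proj₁ sepB) n
          i , N≤i , eq′ = countdown-recurrent m N
          ci≡          = realised i (trans (cong (interleave (proj₁ sepA) (proj₁ sepB)) eq′) eq)
      in i , N≤i , subst (λ z → A.d z x ≤ ε) (sym ci≡) (proj₁ near)

    d-dense : ∀ y ε N → 0# < ε → ∃[ i ] N ℕ.≤ i × B.d (d i) y ≤ ε
    d-dense y ε N 0<ε =
      let n , near     = proj₂ sepB y ε 0<ε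
          m , eq       = interleave-inj₂ (proj₁ sepA) (proj₁ sepB) n
          i , N≤i , eq′ = countdown-recurrent m N
          di≡          = realised i (trans (cong (interleave (proj₁ sepA) (proj₁ sepB)) eq′) eq)
      in i , N≤i , subst (λ z → B.d z y ≤ ε) (sym di≡) (proj₁ near)

    -- With M = t / ε, the modulus of M φ in late variables is at most Ω, so the values
    -- of M φ differ by at most t.
    atomic-late : 0# < val t → ∀ {l} (φ : Atomic L l) ε → 0# < ε → ∃[ N ]
                  (∀ ι → Increasing ι → N ℕ.≤ ι 0 →
                   ∣ proj₁ (evalᴬ A φ (c ∘ ι ∘ toℕ)) - proj₁ (evalᴬ B φ (d ∘ ι ∘ toℕ)) ∣ ≤ ε)
    atomic-late 0<t {l} φ ε 0<ε =
      let M , 0<M , εM≈t = divide 0<ε 0<t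
          M⁺             = M ,⁺ proj₁ 0<M
          N , late       = UniversalProperties.Δᴬ-late U φ M⁺ 0<M
      in N , λ ι inc N≤ι₀ →
        let σ : Fin l → Fin (ι l ℕ.+ k)
            σ q = position (entry-ι inc q)
            ψ = renameᴬ σ φ
            ψ-close = basic-close (ι l) (scaled M⁺ 0<M ψ) λ δ →
              ≼-trans (Δᴮ-scaled M⁺ 0<M ψ δ)
                (≼-trans (wrap (*-monoʳ-≤ (proj₁ 0<M) (Δᴬ-rename σ φ δ)))
                  (late σ (λ p → ι p ℕ.+ k) (λ p → ℕₚ.+-monoˡ-< k (inc p))
                    (ℕₚ.≤-trans N≤ι₀ (ℕₚ.m≤m+n (ι 0) k)) (λ q → index (entry-ι inc q)) δ))
            ψ-close′ = *-∣-∣-cancel 0<M (T.≤-respʳ-≈ (R.trans (R.sym εM≈t) (R.*-comm ε M)) ψ-close)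
        in T.≤-respʳ-≈ (R.trans (R.+-identityˡ _) (R.+-identityʳ ε))
             (∣-∣-trans (≈⇒∣-∣≤ (R.sym (Aₚ.evalᴬ-rename σ φ (λ q → at-left (entry-ι inc q)))) T.refl)
               (∣-∣-trans ψ-close′ (≈⇒∣-∣≤ (Bₚ.evalᴬ-rename σ φ (λ q → at-right (entry-ι inc q))) T.refl)))

  -- Cluster points and the isomorphism

  module _ {L : Signature} (A B : Structure L)
           (c : ℕ → Structure.Carrier A) (d : ℕ → Structure.Carrier B) where
    private
      module A = Structure A
      module B = Structure B
      module Aₚ = StructureProperties A
      module Bₚ = StructureProperties B

    ClusterPoint : A.Carrier → B.Carrier → Set
    ClusterPoint x y = ∀ ε N → 0# < ε → ∃[ i ] N ℕ.≤ i × A.d (c i) x ≤ ε × B.d (d i) y ≤ ε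

    LateDistances : Set
    LateDistances = ∀ ε → 0# < ε → ∃[ N ] ∀ i j → N ℕ.≤ i → i ℕ.< j →
                    ∣ A.d (c i) (c j) - B.d (d i) (d j) ∣ ≤ ε

    module _ (late : LateDistances) where

      -- `late` compares distances for `i < j` only. Symmetry of the metrics covers `j < i`, and on
      -- the diagonal the distance is 0.
      late-cauchy : ∀ ε → 0# < ε → ∃[ N ] ∀ i j → N ℕ.≤ i → N ℕ.≤ j →
                    A.d (c i) (c j) ≤ ε → B.d (d i) (d j) ≤ ε + ε
      late-cauchy ε 0<ε =
        let N , close = late ε 0<ε
        in N , λ i j N≤i N≤j → go i j (close i j N≤i) (close j i N≤j)
        where
        go : ∀ i j → (i ℕ.< j → ∣ A.d (c i) (c j) - B.d (d i) (d j) ∣ ≤ ε) →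
             (j ℕ.< i → ∣ A.d (c j) (c i) - B.d (d j) (d i) ∣ ≤ ε) →
             A.d (c i) (c j) ≤ ε → B.d (d i) (d j) ≤ ε + ε
        go i j i<j⇒ j<i⇒ dc≤ with ℕₚ.<-cmp i j
        ... | tri< i<j _ _ = T.trans (∣x-y∣≤⇒y≤ (i<j⇒ i<j)) (R.+-monoˡ-≤ ε dc≤)
        ... | tri≈ _ i≡j _ = Bₚ.d-refl≤ (cong d i≡j) (T.trans (proj₁ 0<ε) (x≤x+y (proj₁ 0<ε)))
        ... | tri> _ _ j<i = Bₚ.d-sym≤ (T.trans (∣x-y∣≤⇒y≤ (j<i⇒ j<i)) (R.+-monoˡ-≤ ε (Aₚ.d-sym≤ dc≤)))

      -- Indices `i p ≥ p` with `c (i p)` within `2⁻ p` of `x` make `c ∘ i` Cauchy. The comparison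
      -- of late distances transfers this to `d ∘ i`, whose limit is the partner of `x`.
      cluster-total : ∀ x → (∀ ε N → 0# < ε → ∃[ i ] N ℕ.≤ i × A.d (c i) x ≤ ε) → ∃[ y ] ClusterPoint x y
      cluster-total x hits =
        let y , converges = B.complete (d ∘ i) cauchy
        in y , λ ε N 0<ε →
          let P , 2⁻P<ε = 2⁻-null ε 0<ε
              N′ , near = converges ε 0<ε
              p         = N ℕ.⊔ (P ℕ.⊔ N′)
              P⊔N′≤p    = ℕₚ.m≤n⊔m N (P ℕ.⊔ N′)
          in i p , ℕₚ.≤-trans (ℕₚ.m≤m⊔n N (P ℕ.⊔ N′)) (p≤i p)
            , T.trans (close p) (T.trans (2⁻-antitone (ℕₚ.≤-trans (ℕₚ.m≤m⊔n P N′) P⊔N′≤p)) (proj₁ 2⁻P<ε))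
            , proj₁ (near p (ℕₚ.≤-trans (ℕₚ.m≤n⊔m P N′) P⊔N′≤p))
        where
        i : ℕ → ℕ
        i p = proj₁ (hits (2⁻ p) p (2⁻-pos p))

        p≤i : ∀ p → p ℕ.≤ i p
        p≤i p = proj₁ (proj₂ (hits (2⁻ p) p (2⁻-pos p)))

        close : ∀ p → A.d (c (i p)) x ≤ 2⁻ p
        close p = proj₂ (proj₂ (hits (2⁻ p) p (2⁻-pos p)))

        cauchy : ∀ ε → 0# < ε → ∃[ N ] ∀ m n → N ℕ.≤ m → N ℕ.≤ n → B.d (d (i m)) (d (i n)) < ε
        cauchy ε 0<ε =
          -- The tolerances are ε/2, ε/4 and ε/8: two points within ε/8 of `x` are within ε/4 of
          -- each other, and their partners then within ε/2.
          let 0<h         = 0<half 0<ε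
              0<q         = 0<half 0<h
              0<e         = 0<half 0<q
              N , d-close = late-cauchy (half 0<h) 0<q
              P , 2⁻P<e   = 2⁻-null (half 0<q) 0<e
              c-close : ∀ m → N ℕ.⊔ P ℕ.≤ m → A.d (c (i m)) x ≤ half 0<q
              c-close m N⊔P≤m = T.trans (close m)
                (T.trans (2⁻-antitone (ℕₚ.≤-trans (ℕₚ.m≤n⊔m N P) N⊔P≤m)) (proj₁ 2⁻P<e))
              N≤i : ∀ m → N ℕ.⊔ P ℕ.≤ m → N ℕ.≤ i m
              N≤i m N⊔P≤m = ℕₚ.≤-trans (ℕₚ.≤-trans (ℕₚ.m≤m⊔n N P) N⊔P≤m) (p≤i m)
          in N ℕ.⊔ P , λ m n m≥ n≥ → ≤-<-trans
               (d-close (i m) (i n) (N≤i m m≥) (N≤i n n≥)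
                 (T.≤-respʳ-≈ (half+half 0<q) (Aₚ.d-triangle (c-close m m≥) (Aₚ.d-sym≤ (c-close n n≥)))))
               (≤-<-trans (T.reflexive (half+half 0<h)) (half< 0<ε))

  module _ {L : Signature} {W : WeakModulus} (U : IsUniversal L W) (A B : Structure L)
    (c : ℕ → Structure.Carrier A) (d : ℕ → Structure.Carrier B)
    (late : ∀ {l} (φ : Atomic L l) ε → 0# < ε → ∃[ N ] (∀ ι → Increasing ι → N ℕ.≤ ι 0 →
            ∣ proj₁ (evalᴬ A φ (c ∘ ι ∘ toℕ)) - proj₁ (evalᴬ B φ (d ∘ ι ∘ toℕ)) ∣ ≤ ε))
    (c-dense : ∀ x ε N → 0# < ε → ∃[ i ] N ℕ.≤ i × Structure.d A (c i) x ≤ ε)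
    (d-dense : ∀ y ε N → 0# < ε → ∃[ i ] N ℕ.≤ i × Structure.d B (d i) y ≤ ε) where
    private
      module A = Structure A
      module B = Structure B
      module Aₚ = StructureProperties A
      module Bₚ = StructureProperties B

      _∼_ : A.Carrier → B.Carrier → Set
      _∼_ = ClusterPoint A B c d

    -- Late indices are chosen with `c (ι q)` near `x q` and `d (ι q)` near `y q` at once. Passing
    -- from `x` to `c`, on to `d` and on to `y` costs ε/4, ε/2 and ε/4.
    cluster-atomic : ∀ {l} (φ : Atomic L l) x y → (∀ q → x q ∼ y q) →
                     proj₁ (evalᴬ A φ x) ≈ proj₁ (evalᴬ B φ y)
    cluster-atomic {l} φ x y x∼y = ∣-∣≤ε⇒≈ λ ε 0<ε →
      let h               = half 0<ε
          0<h             = 0<half 0<ε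
          q               = half 0<h
          0<q             = 0<half 0<h
          N , close       = late φ h 0<h
          η , 0<η , small = UniversalProperties.Δᴬ-small U φ q 0<q
          ι , inc , N≤ι₀ , near = choose-increasing l
            (λ q i → A.d (c i) (x q) ≤ η × B.d (d i) (y q) ≤ η) (λ q N → x∼y q η N 0<η) N
      in T.≤-respʳ-≈ (sum≈ε 0<ε)
           (∣-∣-trans (T.trans (∣-∣-sym (Aₚ.evalᴬ-respects φ (c ∘ ι ∘ toℕ) x)) (small _ (proj₁ ∘ near)))
             (∣-∣-trans (close ι inc N≤ι₀)
               (T.trans (Bₚ.evalᴬ-respects φ (d ∘ ι ∘ toℕ) y) (small _ (proj₂ ∘ near)))))
      where
      sum≈ε : ∀ {ε} (0<ε : 0# < ε) →
              half (0<half 0<ε) + (half 0<ε + half (0<half 0<ε)) ≈ ε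
      sum≈ε 0<ε = R.trans (+ₛ.x∙yz≈y∙xz _ _ _)
        (R.trans (R.+-congˡ (half+half (0<half 0<ε))) (half+half 0<ε))

    late-distances : LateDistances A B c d
    late-distances ε 0<ε =
      let N , close = late (atom dist var) ε 0<ε
      -- The indices `i` and `j` are extended to an increasing map, of which the formula reads only
      -- the first two values.
      in N , λ i j N≤i i<j → close (i ◂ j ◂ (suc j ℕ.+_))
           (◂-increasing i<j (◂-increasing (ℕ.s≤s (ℕₚ.m≤m+n j 0)) λ p → ℕₚ.+-monoʳ-< (suc j) (ℕₚ.n<1+n p)))
           N≤i

    cluster-dist : ∀ {x x′ y y′} → x ∼ y → x′ ∼ y′ → A.d x x′ ≈ B.d y y′
    cluster-dist {x} {x′} {y} {y′} x∼y x′∼y′ =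
      cluster-atomic (atom dist var) (x ∷ x′ ∷ []) (y ∷ y′ ∷ []) λ { zero → x∼y ; (suc zero) → x′∼y′ }

    cluster-totalˡ : ∀ x → ∃[ y ] x ∼ y
    cluster-totalˡ x = cluster-total A B c d late-distances x (c-dense x)

    cluster-totalʳ : ∀ y → ∃[ x ] x ∼ y
    cluster-totalʳ y =
      let x , y∼x = cluster-total B A d c
            (λ ε 0<ε → let N , close = late-distances ε 0<ε in N , λ i j N≤i i<j → ∣-∣-sym (close i j N≤i i<j))
            y (d-dense y)
      in x , λ ε N 0<ε → let i , N≤i , dy , cx = y∼x ε N 0<ε in i , N≤i , cx , dy

    -- `to` selects any partner. By `cluster-dist` the relation preserves distances, so partners are
    -- unique up to distance 0 and `to` is a well-defined isometry.
    cluster-isomorphism : Σ[ f ∈ Isomorphism A B ] ∀ x → x ∼ Isomorphism.to f x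
    cluster-isomorphism = f , x∼to
      where
      to : A.Carrier → B.Carrier
      to x = proj₁ (cluster-totalˡ x)

      x∼to : ∀ x → x ∼ to x
      x∼to x = proj₂ (cluster-totalˡ x)

      isometric : ∀ x x′ → A.d x x′ ≈ B.d (to x) (to x′)
      isometric x x′ = cluster-dist (x∼to x) (x∼to x′)

      f : Isomorphism A B
      f = record
        { to          = to
        ; isBijection = record
          { isInjection = record
            { isCongruent = record
              { cong           = λ {x} {x′} x≈x′ → Bₚ.d≤0⇒≈ (T.≤-respˡ-≈ (isometric x x′) (Aₚ.≈⇒d≤0 x≈x′))
              ; isEquivalence₁ = Aₚ.M.≈-isEquivalence
              ; isEquivalence₂ = Bₚ.M.≈-isEquivalence
              }
            ; injective   = λ {x} {x′} tx≈tx′ → Aₚ.d≤0⇒≈ (T.≤-respˡ-≈ (R.sym (isometric x x′)) (Bₚ.≈⇒d≤0 tx≈tx′))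
            }
          -- For `z` equal to a partner `x` of `y`, the distance between `to z` and `y` is that
          -- between `z` and `x`, namely 0.
          ; surjective  = λ y → let x , x∼y = cluster-totalʳ y in
              x , λ {z} z≈x → Bₚ.d≤0⇒≈ (T.≤-respˡ-≈ (cluster-dist (x∼to z) x∼y) (Aₚ.≈⇒d≤0 z≈x))
          }
        -- The atomic formula is the distance between F of the later variables and variable 0. With
        -- F(x) for variable 0 it vanishes in `A`, hence in `B` at the image tuple.
        ; fun-pres    = λ F x → Bₚ.d≤0⇒≈ (Bₚ.d-sym≤ (T.≤-respˡ-≈
            (cluster-atomic (atom dist (app F (var ∘ suc) ∷ var zero ∷ [])) (A.fun F x ∷ x) (to (A.fun F x) ∷ (to ∘ x))
              λ { zero → x∼to (A.fun F x) ; (suc i) → x∼to (x i) })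
            (Aₚ.≈⇒d≤0 Aₚ.M.EqC.refl)))
        ; pred-pres   = λ P x → cluster-atomic (atom P var) x (to ∘ x) (x∼to ∘ x)
        }

  -- The distance formula

  open Min R.totalOrder using () renaming (_⊓_ to min; x⊓y≤x to min≤ˡ; x⊓y≤y to min≤ʳ; ⊓-glb to min-glb)

  module Truncation (K : ℝ≥0) where

    trunc : [0,∞] → Real
    trunc (fin x) = min (val x) (val K)
    trunc ∞       = val K

    trunc≤K : ∀ X → trunc X ≤ val K
    trunc≤K (fin x) = min≤ʳ (val x) (val K)
    trunc≤K ∞       = T.refl

    trunc-≤ : ∀ {X x} → X ≼ fin x → trunc X ≤ val x
    trunc-≤ {fin y} (wrap y≤x) = T.trans (min≤ˡ (val y) (val K)) y≤x

    -- A truncated value below `K` is the true value, whereas the value `K` may stand for anything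
    -- larger. This is why the bound must be strictly below `K`.
    trunc-reflects-≤ : ∀ {X x} → trunc X ≤ val x → val x < val K → X ≼ fin x
    trunc-reflects-≤ {fin y} min≤x x<K = wrap (by-contradiction λ y≰x → go y≰x min≤x (T.total (val y) (val K)))
      where
      go : ¬ val y ≤ _ → min (val y) (val K) ≤ _ → val y ≤ val K ⊎ val K ≤ val y → _
      go y≰x min≤x (inj₁ y≤K) = y≰x (T.trans (min-glb T.refl y≤K) min≤x)
      go y≰x min≤x (inj₂ K≤y) = <⇒≱ x<K (T.trans (min-glb K≤y T.refl) min≤x)
    trunc-reflects-≤ {∞}     K≤x   x<K = contradiction K≤x (<⇒≱ x<K)

    trunc-+ : ∀ {X Y z} → X ≼ (Y +∞ fin z) → trunc X ≤ trunc Y + val z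
    trunc-+ {X}     {∞}     {z} _ = T.trans (trunc≤K X) (x≤x+y (nonneg z))
    trunc-+ {fin x} {fin y} {z} (wrap x≤y+z) = go (T.total (val y) (val K))
      where
      go : val y ≤ val K ⊎ val K ≤ val y → trunc (fin x) ≤ trunc (fin y) + val z
      go (inj₁ y≤K) = T.trans (min≤ˡ (val x) (val K))
        (T.trans x≤y+z (R.+-monoˡ-≤ (val z) (min-glb T.refl y≤K)))
      go (inj₂ K≤y) = T.trans (trunc≤K (fin x))
        (T.trans (x≤x+y (nonneg z)) (R.+-monoˡ-≤ (val z) (min-glb K≤y T.refl)))

    -- [0,∞] has no subtraction, so that `X` and `Y` differ by at most `Z` is expressed by two
    -- inequalities. Capping at `K` is 1-Lipschitz.
    trunc-lipschitz : ∀ {X Y Z} → X ≼ (Y +∞ Z) → Y ≼ (X +∞ Z) → fin ∣ trunc X - trunc Y ∣⁺ ≼ Z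
    trunc-lipschitz {Z = ∞}     _     _     = wrap tt
    trunc-lipschitz {Z = fin z} X≼Y+Z Y≼X+Z = wrap (∣x-y∣≤ (trunc-+ X≼Y+Z) (trunc-+ Y≼X+Z))

  -- The formula Ω(d(x_{π q}, x_{σ q}))_q; the truncation makes it real-valued, and
  -- the absolute values extend it to boxes that contain negative numbers.
  module DistanceFormula {L : Signature} (W : WeakModulus) (K : ℝ≥0)
    {n k : ℕ} (π σ : Fin k → Fin n) where
    open WeakModulusProperties W
    open Truncation K

    distance-atoms : Vector (Atomic L n) k
    distance-atoms q = atom dist (var (π q) ∷ var (σ q) ∷ [])

    truncated : Box (boundᴬ ∘ distance-atoms) → Real
    truncated x = trunc (W ↾ (λ q → ∣ proj₁ (x q) ∣⁺))

    -- Coordinatewise |x| is at most |y| + ζ, and Ω is monotone and subadditive. This one estimate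
    -- yields both the continuity of the formula and its modulus.
    truncated-lipschitz : ∀ x y (ζ : Vector ℝ≥0 k) → (∀ q → ∣ proj₁ (x q) - proj₁ (y q) ∣ ≤ val (ζ q)) →
                          fin ∣ truncated x - truncated y ∣⁺ ≼ W ↾ ζ
    truncated-lipschitz x y ζ near = trunc-lipschitz
      (≼-trans (↾-mono λ q → ∣x∣≤∣y∣+ (near q)) (↾-subadd (λ q → ∣ proj₁ (y q) ∣⁺) ζ))
      (≼-trans (↾-mono λ q → ∣x∣≤∣y∣+ (∣-∣-sym (near q))) (↾-subadd (λ q → ∣ proj₁ (x q) ∣⁺) ζ))

    distance-formula : Basic L n
    distance-formula = record
      { atoms      = distance-atoms
      ; f          = truncated
      ; continuous = λ x ε 0<ε →
          let η , 0<η , small = ↾-small k (half 0<ε) (0<half 0<ε)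
          in η , 0<η , λ y near → ≤-<-trans
               (unwrap (≼-trans (truncated-lipschitz x y (λ q → ∣ proj₁ (x q) - proj₁ (y q) ∣⁺) (λ _ → T.refl))
                 (small _ (proj₁ ∘ near))))
               (half< 0<ε)
      }

    Δᴮ-distance-formula : ∀ δ → Δᴮ distance-formula δ ≼ W ↾ ((δ ∘ π) ⊕ (δ ∘ σ))
    Δᴮ-distance-formula δ = sup-≼ _ λ (x , y , near) → truncated-lipschitz x y ((δ ∘ π) ⊕ (δ ∘ σ)) near

  module _ {L : Signature} {W : WeakModulus} (U : IsUniversal L W) (A B : Structure L)
    (sepA : Separable A) (sepB : Separable B)
    (t : ℝ≥0) {k : ℕ} (v : Vector (Structure.Carrier A) k) (w : Vector (Structure.Carrier B) k)
    (t⋠ : ¬ fin t ≼ BackAndForth.r∞ W A B v w) where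

    open BackAndForthSequences U A B sepA sepB t v w t⋠
    open IsUniversal U
    open WeakModulusProperties W
    private
      module A = Structure A
      module B = Structure B
      module Aₚ = StructureProperties A
      module Bₚ = StructureProperties B

    -- The absolute values give these distances the shape of the arguments of Ω in `truncated`.
    left-distances right-distances : (ℕ → ℕ) → Vector ℝ≥0 k
    left-distances ι q = ∣ A.d (v q) (c (ι (toℕ q))) ∣⁺
    right-distances ι q = ∣ B.d (w q) (d (ι (toℕ q))) ∣⁺

    module _ {ι : ℕ → ℕ} (inc : Increasing ι) (K : ℝ≥0) where
      private
        initial : (q : Fin k) → Entry (ι k) (toℕ q) (v q) (w q)
        initial = entry-initial (ι k)

        later : (q : Fin k) → Entry (ι k) (ι (toℕ q) ℕ.+ k) (c (ι (toℕ q))) (d (ι (toℕ q)))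
        later = entry-ι inc

      open Truncation K
      open DistanceFormula {L} W K (position ∘ initial) (position ∘ later)

      -- The modulus is at most Ω at the initial coordinates plus Ω at the later ones. `universal₃`
      -- joins the two blocks, and `Ω-embed` keeps the first in place while moving the second to its
      -- positions in the stage.
      distance-formula-bounded : ∀ δ → Δᴮ distance-formula δ ≼ W ↾ δ
      distance-formula-bounded δ =
        let δᵥ = δ ∘ position ∘ initial
            δᵤ = δ ∘ position ∘ later
        in ≼-trans (Δᴮ-distance-formula δ) (≼-trans (↾-subadd δᵥ δᵤ)
             (≼-trans (wrap (universal₃ δᵥ δᵤ))
               (Ω-embed universal₄ k {λ p → ι p ℕ.+ k} (λ p → ℕₚ.+-monoˡ-< k (inc p)) (ℕₚ.m≤n+m k (ι 0))
                 (λ p p<k → T.trans (≡⇒≤ (cong val (pad-++ˡ δᵥ δᵤ p<k)))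
                   (pad-reindex (position ∘ initial) (λ p → p) (λ q → index (initial q)) δ p))
                 (λ p → T.trans (≡⇒≤ (cong val (pad-++ʳ δᵥ δᵤ p)))
                   (pad-reindex (position ∘ later) (λ p → ι p ℕ.+ k) (λ q → index (later q)) δ p)))))

      -- The formula has value at most `h` in `A`, so at most `h + t` in `B`. As `K` is larger, the
      -- truncation does not hide the value of Ω.
      distances-close : ∀ h → val h + val t < val K → W ↾ left-distances ι ≼ fin h →
                        W ↾ right-distances ι ≼ fin (h +⁺ t)
      distances-close h h+t<K left≼h =
        ≼-trans (↾-mono rightʷ) (trunc-reflects-≤ {W ↾ right} {h +⁺ t} right≤h+t h+t<K)
        where
        a = Stage.left (stage (ι k))
        b = Stage.right (stage (ι k))

        left right : Vector ℝ≥0 k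
        left q = ∣ A.d (a (position (initial q))) (a (position (later q))) ∣⁺
        right q = ∣ B.d (b (position (initial q))) (b (position (later q))) ∣⁺

        leftʷ : left ⊑ left-distances ι
        leftʷ q = ≡⇒≤ (cong ∣_∣ (cong₂ A.d (at-left (initial q)) (at-left (later q))))

        rightʷ : right-distances ι ⊑ right
        rightʷ q = ≡⇒≤ (cong ∣_∣ (sym (cong₂ B.d (at-right (initial q)) (at-right (later q)))))

        close′ : ∣ trunc (W ↾ left) - trunc (W ↾ right) ∣ ≤ val t
        close′ = basic-close (ι k) distance-formula distance-formula-bounded

        left≤h : trunc (W ↾ left) ≤ val h
        left≤h = trunc-≤ {W ↾ left} {h} (≼-trans (↾-mono leftʷ) left≼h)

        right≤h+t : trunc (W ↾ right) ≤ val h + val t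
        right≤h+t = T.trans (∣x-y∣≤⇒y≤ close′) (R.+-monoˡ-≤ (val t) left≤h)

    -- The triangle inequality through `d (ι q)` splits the distance from `g (v q)` to `w q`.
    dist^-near : ∀ g {ι} → Increasing ι → ∀ h → W ↾ left-distances ι ≼ fin h →
                 W ↾ (λ q → B.d⁺ (g (v q)) (d (ι (toℕ q)))) ≼ fin h →
                 dist^ W B (g ∘ v) w ≼ fin (h +⁺ (h +⁺ t))
    dist^-near g {ι} inc h left≼h moved≼h = ≼-trans
      (↾-mono {ys = moved ⊕ right-distances ι} λ q →
        Bₚ.d-triangle T.refl (Bₚ.d-sym≤ (x≤∣x∣ (B.d (w q) (d (ι (toℕ q)))))))
      (≼-trans (↾-subadd moved (right-distances ι)) (+∞-mono moved≼h
        -- The cap `h + t + 1` only has to exceed `h + t`.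
        (distances-close inc ((h +⁺ t) +⁺ (1# ,⁺ 0≤1)) h (x<x+y 0<1) left≼h)))
      where
      moved : Vector ℝ≥0 k
      moved q = B.d⁺ (g (v q)) (d (ι (toℕ q)))

    dist^-cluster : (g : A.Carrier → B.Carrier) → (∀ q → ClusterPoint A B c d (v q) (g (v q))) →
                    dist^ W B (g ∘ v) w ≼ fin t
    dist^-cluster g v∼gv = ≼-by-ε approximate
      where
      approximate : ∀ ε (0<ε : 0# < ε) → dist^ W B (g ∘ v) w ≼ fin (t +⁺ (ε ,⁺ proj₁ 0<ε))
      approximate ε 0<ε with halve 0<ε
      ... | h , 0<h , h+h≈ε with ↾-small k h 0<h
      -- The threshold for the indices is 0, because `c (ι p)` and `d (ι p)` sit at position
      -- `ι p + k`, already behind the initial tuples.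
      ... | η , 0<η , small with choose-increasing k
            (λ q i → A.d (c i) (v q) ≤ η × B.d (d i) (g (v q)) ≤ η) (λ q N → v∼gv q η N 0<η) 0
      ... | ι , inc , _ , near = ≼-trans
        (dist^-near g inc (h ,⁺ proj₁ 0<h)
          (small (left-distances ι) λ q → T.trans (∣x∣≤x Aₚ.M.nonNegative) (Aₚ.d-sym≤ (proj₁ (near q))))
          (small _ λ q → Bₚ.d-sym≤ (proj₂ (near q))))
        (wrap (T.reflexive (R.trans (R.sym (R.+-assoc h h (val t)))
          (R.trans (R.+-congʳ h+h≈ε) (R.+-comm ε (val t))))))

    -- Positivity of `t` enters through the scaling factor t/ε in `atomic-late`, on which the
    -- isomorphism rests.
    inf-dist^≼ : 0# < val t → inf (λ (f : Isomorphism A B) → dist^ W B (Isomorphism.to f ∘ v) w) ≼ fin t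
    inf-dist^≼ 0<t = via (cluster-isomorphism U A B c d (atomic-late 0<t) c-dense d-dense)
      where
      via : (Σ[ f ∈ Isomorphism A B ] ∀ x → ClusterPoint A B c d x (Isomorphism.to f x)) →
            inf (λ (f : Isomorphism A B) → dist^ W B (Isomorphism.to f ∘ v) w) ≼ fin t
      via (f , x∼fx) = ≼-trans (inf-≼ (λ f → dist^ W B (Isomorphism.to f ∘ v) w) f)
        (dist^-cluster (Isomorphism.to f) (x∼fx ∘ v))

  -- The equality and the case of empty tuples

  module _ {L : Signature} {W : WeakModulus} (U : IsUniversal L W) (A B : Structure L)
           (sepA : Separable A) (sepB : Separable B) where
    open BackAndForth W A B using (r∞)
    private
      module A = Structure A
      module B = Structure B

    inf-dist^≼r∞ : ∀ {k} (v : Vector A.Carrier k) (w : Vector B.Carrier k) →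
                   inf (λ (f : Isomorphism A B) → dist^ W B (Isomorphism.to f ∘ v) w) ≼ r∞ v w
    inf-dist^≼r∞ v w = go (r∞ v w) refl
      where
      go : ∀ x → r∞ v w ≡ x → inf (λ (f : Isomorphism A B) → dist^ W B (Isomorphism.to f ∘ v) w) ≼ x
      go ∞       _  = wrap tt
      -- The construction asks for `r∞ < t` and `0 < t`. Both hold for `t = ρ + ε`, and ε is
      -- arbitrary.
      go (fin ρ) eq = ≼-by-ε λ ε 0<ε → inf-dist^≼ U A B sepA sepB (ρ +⁺ (ε ,⁺ proj₁ 0<ε)) v w
        (λ ρ+ε≼ → <⇒≱ (x<x+y 0<ε) (unwrap (≼-trans ρ+ε≼ (≼-reflexive eq))))
        (<-≤-trans 0<ε (x≤y+x (nonneg ρ)))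

    r∞≈inf-dist^ : ∀ {k} (v : Vector A.Carrier k) (w : Vector B.Carrier k) →
                   r∞ v w ≈∞ inf (λ (f : Isomorphism A B) → dist^ W B (Isomorphism.to f ∘ v) w)
    r∞≈inf-dist^ v w = ≼-antisym (≼-inf _ λ f → r∞≼dist^ f W v w) (inf-dist^≼r∞ v w)

    r∞≈0 : Isomorphism A B → r∞ [] [] ≈∞ fin 0⁺
    -- For empty tuples d^Ω is Ω at the zero sequence.
    r∞≈0 f = ≼-antisym (≼-trans (r∞≼dist^ f W [] []) (WeakModulusProperties.Ω-zero W)) (zero-least (r∞ [] []))
      where
      zero-least : ∀ x → fin 0⁺ ≼ x
      zero-least (fin x) = wrap (nonneg x)
      zero-least ∞       = wrap tt

    r∞≈∞ : ¬ Isomorphism A B → r∞ [] [] ≈∞ ∞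
    r∞≈∞ ¬f = ≼-antisym (wrap tt) (≼-trans
      (≼-inf (λ f → dist^ W B (Isomorphism.to f ∘ []) []) λ f → contradiction f ¬f) (inf-dist^≼r∞ [] []))

theorem5p5 : (em : ∀ {ℓ} → ExcludedMiddle ℓ) (ℝ : CompleteOrderedField) →
    let open Theory em ℝ in
    (L : Signature) → Countable L →
    (Ω : WeakModulus) → IsUniversal L Ω →
    (A B : Structure L) → Separable A → Separable B →
    let open BackAndForth Ω A B using (r∞) in
    (∀ (k : ℕ) (v : Vector (Structure.Carrier A) k) (w : Vector (Structure.Carrier B) k) →
    r∞ v w ≈∞ inf (λ (f : Isomorphism A B) → dist^ Ω B (Isomorphism.to f ∘ v) w))
    × (Isomorphism A B → r∞ [] [] ≈∞ fin 0⁺)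
    × (¬ Isomorphism A B → r∞ [] [] ≈∞ ∞)
theorem5p5 em ℝ L _ Ω U A B sepA sepB =
  (λ k → r∞≈inf-dist^ em ℝ U A B sepA sepB) , r∞≈0 em ℝ U A B sepA sepB , r∞≈∞ em ℝ U A B sepA sepB
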